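{- Let $H$ be the graph on vertex set $\{0,1,2,3\}$ with exactly one red edge $\{0,2\}$, exactly one blue edge $\{1,3\}$, and no other edges. Let $n\ge 4$ be an integer and define $k_0:=\lfloor x_0\rfloor$, where $$x_0:=\frac{3+\sqrt{2n^2-10n+13}}{2}.$$ Then $\Lambda_H(n)=\Lambda_H\big(QC(n,\binom{k_0+1}{2})\big)$. Moreover, if $2n^2-10n+13$ is not the square of an integer, then, up to isomorphism, $QC(n,\binom{k_0+1}{2})$ and its complement are the only graphs $G$ of order $n$ with $\Lambda_H(G)=\Lambda_H(n)$; if $2n^2-10n+13$ is the square of an integer, then there are at least $2(k_0+1)$ pairwise non-isomorphic graphs $G$ of order $n$ with $\Lambda_H(G)=\Lambda_H(n)$.
   Context: All graphs are finite and simple; the order of a graph is its number of vertices. For a graph $H$ whose edges are coloured red or blue and an uncoloured graph $G$, an embedding of $H$ into $G$ is an injection $V(H)\to V(G)$ that maps red edges of $H$ to edges of $G$ and blue edges of $H$ to non-edges of $G$ (pairs of distinct non-adjacent vertices). $\Lambda_H(G)$ is the number of embeddings of $H$ into $G$, and $\Lambda_H(n)$ is the maximum of $\Lambda_H(G)$ over all graphs $G$ of order $n$. For integers $n$ and $1\le e\le\binom n2$, the quasi-clique $QC(n,e)$ is the graph with $n$ vertices and $e$ edges obtained as follows: let $k$ be the maximum integer with $\binom k2<e$; take the complete graph $K_{k+1}$, remove $\binom{k+1}{2}-e$ edges forming a star (all incident to one common vertex), and add $n-k-1$ isolated vertices. -}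

module Defs where

open import Data.Bool using (Bool; true; false; not; _∧_; _∨_)
import Data.Bool.Properties as Bool
open import Data.Fin using (Fin; toℕ)
import Data.Fin as Fin
open import Data.Fin.Patterns using (0F; 1F; 2F; 3F)
open import Data.Fin.Permutation using (Permutation′; _⟨$⟩ʳ_)
import Data.Fin.Properties as Fin
open import Data.Integer using (ℤ; +_)
import Data.Integer as ℤ
import Data.Integer.Properties as ℤ
open import Data.Integer.Tactic.RingSolver using (solve-∀)
open import Data.List using (List; []; _∷_; length; filter; allFin; upTo; cartesianProductWith)
open import Data.List.Extrema.Nat using (argmax; max; f[xs]≤f[argmax]; argmax-all; xs≤max)
open import Data.List.Membership.Propositional using (_∈_)
open import Data.List.Membership.Propositional.Properties
  using (∈-allFin; ∈-cartesianProductWith⁺; ∈-filter⁺; ∈-upTo⁺; ∈-map⁺)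
import Data.List as List
open import Data.List.Properties using (filter-≐)
open import Data.List.Relation.Unary.All using () renaming (lookup to All-lookup)
open import Data.List.Relation.Unary.All.Properties using (all-filter)
open import Data.List.Relation.Unary.Any using (here; there)
open import Data.Maybe using (Maybe; just; nothing)
import Data.Maybe.Properties as Maybe
open import Data.Nat using (ℕ; zero; suc; _+_; _*_; _∸_; _≤_; _<_; z≤n; s≤s)
import Data.Nat as ℕ
import Data.Nat.Properties as ℕ
open import Data.Nat.Combinatorics using (_C_; nCk+nC[k+1]≡[n+1]C[k+1]; nC1≡n)
open import Data.Product using (_×_; _,_; Σ-syntax; ∃-syntax; proj₁; proj₂)
open import Data.Sum using (_⊎_; inj₁; inj₂)
open import Data.Vec using (Vec; []; _∷_; lookup; tabulate)
open import Data.Vec.Properties using (lookup∘tabulate)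
open import Function using (Injective; _∘_)
open import Relation.Binary.Definitions using (DecidableEquality; tri<; tri≈; tri>)
open import Relation.Binary.PropositionalEquality
  using (_≡_; _≢_; refl; sym; trans; cong; cong₂; subst; subst₂)
open import Relation.Nullary using (¬_; Dec; yes; no; does)
open import Relation.Nullary.Decidable
  using (map′; _×-dec_; _⊎-dec_; _→-dec_; from-yes; dec-true; dec-false)
open import Relation.Unary using (Pred; Decidable)
open import Level using (0ℓ)

record Graph (n : ℕ) : Set where
  field
    adj    : Fin n → Fin n → Bool
    symm   : ∀ i j → adj i j ≡ adj j i
    irrefl : ∀ i → adj i i ≡ false

open Graph public

infix 4 _≅_

_≅_ : ∀ {n} → Graph n → Graph n → Set
_≅_ {n} G G′ =
  Σ[ π ∈ Permutation′ n ] (∀ i j → adj G i j ≡ adj G′ (π ⟨$⟩ʳ i) (π ⟨$⟩ʳ j))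

-- The graph in which i < j are adjacent iff E i j; the values E i j with
-- i ≥ j are ignored.
fromUpper : ∀ {n} → (Fin n → Fin n → Bool) → Graph n
fromUpper E = record
  { adj    = λ i j → U i j ∨ U j i
  ; symm   = λ i j → Bool.∨-comm (U i j) (U j i)
  ; irrefl = λ i → cong₂ _∨_ (U-irrefl i) (U-irrefl i)
  }
  where
  U : _ → _ → Bool
  U i j = does (i Fin.<? j) ∧ E i j
  U-irrefl : ∀ i → U i i ≡ false
  U-irrefl i = cong (_∧ E i i) (dec-false (i Fin.<? i) (ℕ.<-irrefl refl))

complement : ∀ {n} → Graph n → Graph n
complement G = record
  { adj    = λ i j → not (does (i Fin.≟ j)) ∧ not (adj G i j)
  ; symm   = λ i j → cong₂ _∧_ (cong not (≟-sym i j)) (cong not (symm G i j))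
  ; irrefl = λ i → cong (λ b → not b ∧ not (adj G i i)) (dec-true (i Fin.≟ i) refl)
  }
  where
  ≟-sym : ∀ i j → does (i Fin.≟ j) ≡ does (j Fin.≟ i)
  ≟-sym i j with i Fin.≟ j
  ... | yes i≡j = sym (dec-true (j Fin.≟ i) (sym i≡j))
  ... | no  i≢j = sym (dec-false (j Fin.≟ i) (i≢j ∘ sym))

data Colour : Set where
  red blue : Colour

_≟ᶜ_ : DecidableEquality Colour
red  ≟ᶜ red  = yes refl
red  ≟ᶜ blue = no λ ()
blue ≟ᶜ red  = no λ ()
blue ≟ᶜ blue = yes refl

-- colour i j is nothing when ij is not an edge.
record ColouredGraph (m : ℕ) : Set where
  field
    colour        : Fin m → Fin m → Maybe Colour
    colour-symm   : ∀ i j → colour i j ≡ colour j i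
    colour-irrefl : ∀ i → colour i i ≡ nothing

open ColouredGraph public

-- A map V(H) → V(G) is stored as the vector of its values.  By injectivity
-- and colour-irrefl, the endpoints of a blue edge have distinct images.
IsEmbedding : ∀ {m n} → ColouredGraph m → Graph n → Vec (Fin n) m → Set
IsEmbedding H G φ =
    Injective _≡_ _≡_ (lookup φ)
  × (∀ i j → colour H i j ≡ just red  → adj G (lookup φ i) (lookup φ j) ≡ true)
  × (∀ i j → colour H i j ≡ just blue → adj G (lookup φ i) (lookup φ j) ≡ false)

isEmbedding? : ∀ {m n} (H : ColouredGraph m) (G : Graph n) → Decidable (IsEmbedding H G)
isEmbedding? H G φ = injective? ×-dec (respects? red true ×-dec respects? blue false)
  where
  injective? = map′ (λ inj {i} {j} → inj i j) (λ inj i j → inj {i} {j})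
    (Fin.all? λ i → Fin.all? λ j → (lookup φ i Fin.≟ lookup φ j) →-dec (i Fin.≟ j))
  respects? : ∀ c b → Dec (∀ i j → colour H i j ≡ just c → adj G (lookup φ i) (lookup φ j) ≡ b)
  respects? c b = Fin.all? λ i → Fin.all? λ j →
    Maybe.≡-dec _≟ᶜ_ (colour H i j) (just c) →-dec (adj G (lookup φ i) (lookup φ j) Bool.≟ b)

allVecs : ∀ {A : Set} → List A → (m : ℕ) → List (Vec A m)
allVecs xs zero    = [] ∷ []
allVecs xs (suc m) = cartesianProductWith _∷_ xs (allVecs xs m)

Λ : ∀ {m n} → ColouredGraph m → Graph n → ℕ
Λ {m} {n} H G = length (filter (isEmbedding? H G) (allVecs (allFin n) m))

fromMatrix : ∀ {n} → Vec (Vec Bool n) n → Graph n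
fromMatrix M = fromUpper λ i j → lookup (lookup M i) j

allGraphs : ∀ n → List (Graph n)
allGraphs n = List.map fromMatrix (allVecs (allVecs (true ∷ false ∷ []) n) n)

edgeless : ∀ n → Graph n
edgeless n = fromUpper λ _ _ → false

maximiser : ∀ {m} → ColouredGraph m → ∀ n → Graph n
maximiser H n = argmax (Λ H) (edgeless n) (allGraphs n)

-- allGraphs n lists every graph up to pointwise equality of adj, so this is a
-- maximum over all graphs; see Λmax-isMaximum.
Λmax : ∀ {m} → ColouredGraph m → ℕ → ℕ
Λmax H n = Λ H (maximiser H n)

-- The largest k ≤ b with P k; see greatest-isGreatest.
greatest : ∀ {P : Pred ℕ 0ℓ} → Decidable P → ℕ → ℕ
greatest P? b = max 0 (filter P? (upTo (suc b)))

-- The largest k with k C 2 < e (for e ≥ 1).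
cliqueParameter : ℕ → ℕ
cliqueParameter e = greatest (λ k → k C 2 ℕ.<? e) e

-- The quasi-clique, for 1 ≤ e ≤ n C 2.  The clique is on 0 , … , k, and the
-- edges removed from it join the vertex k to the first (k+1) C 2 − e vertices.
QC : (n e : ℕ) → Graph n
QC n e = fromUpper λ i j →
  does (toℕ j ℕ.≤? k) ∧ not (does (toℕ j ℕ.≟ k) ∧ does (toℕ i ℕ.<? (suc k C 2 ∸ e)))
  where
  k = cliqueParameter e

H : ColouredGraph 4
H = record
  { colour        = col
  ; colour-symm   = from-yes (Fin.all? λ i → Fin.all? λ j →
                      Maybe.≡-dec _≟ᶜ_ (col i j) (col j i))
  ; colour-irrefl = from-yes (Fin.all? λ i → Maybe.≡-dec _≟ᶜ_ (col i i) nothing)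
  }
  where
  col : Fin 4 → Fin 4 → Maybe Colour
  col 0F 2F = just red
  col 2F 0F = just red
  col 1F 3F = just blue
  col 3F 1F = just blue
  col _  _  = nothing

radicand : ℕ → ℤ
radicand n = + 2 ℤ.* (+ n ℤ.* + n) ℤ.- + 10 ℤ.* + n ℤ.+ + 13

IsSquare : ℤ → Set
IsSquare d = ∃[ z ] d ≡ z ℤ.* z

infix 4 _≤√_ _≤√?_

-- a ≤ √d as real numbers, for d ≥ 0.
_≤√_ : ℤ → ℤ → Set
a ≤√ d = a ℤ.≤ + 0 ⊎ a ℤ.* a ℤ.≤ d

_≤√?_ : ∀ a d → Dec (a ≤√ d)
a ≤√? d = (a ℤ.≤? + 0) ⊎-dec (a ℤ.* a ℤ.≤? d)

-- k ≤ x₀ = (3 + √(radicand n)) / 2, cleared of the denominator.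
_≤x₀[_] : ℕ → ℕ → Set
k ≤x₀[ n ] = + 2 ℤ.* + k ℤ.- + 3 ≤√ radicand n

_≤x₀[_]? : ∀ k n → Dec (k ≤x₀[ n ])
k ≤x₀[ n ]? = (+ 2 ℤ.* + k ℤ.- + 3) ≤√? radicand n

-- ⌊x₀⌋, the largest integer k with k ≤ x₀; it is at least 1, so the search
-- can be over ℕ, and for n ≥ 4 the bound n is no restriction; see k₀-isFloor.
k₀ : ℕ → ℕ
k₀ n = greatest (_≤x₀[ n ]?) n

IsGreatest : Pred ℕ 0ℓ → ℕ → Set
IsGreatest P k = P k × (∀ j → P j → j ≤ k)

greatest-isGreatest : ∀ {P : Pred ℕ 0ℓ} (P? : Decidable P) b →
  P 0 → (∀ j → P j → j ≤ b) → IsGreatest P (greatest P? b)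
greatest-isGreatest P? b p₀ bounded =
    argmax-all (λ k → k) p₀ (all-filter P? (upTo (suc b)))
  , λ j pj → All-lookup (xs≤max 0 _) (∈-filter⁺ P? (∈-upTo⁺ (s≤s (bounded j pj))) pj)

[1+k]C2≡k+kC2 : ∀ k → suc k C 2 ≡ k + k C 2
[1+k]C2≡k+kC2 k =
  trans (sym (nCk+nC[k+1]≡[n+1]C[k+1] k 1)) (cong (_+ k C 2) (nC1≡n k))

cliqueParameter-isGreatest : ∀ e → 1 ≤ e → IsGreatest (λ k → k C 2 < e) (cliqueParameter e)
cliqueParameter-isGreatest e 1≤e =
  greatest-isGreatest (λ k → k C 2 ℕ.<? e) e 1≤e bounded
  where
  bounded : ∀ j → j C 2 < e → j ≤ e
  bounded zero    _  = z≤n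
  bounded (suc j) lt = ℕ.≤-trans
    (s≤s (ℕ.≤-trans (ℕ.m≤m+n j (j C 2)) (ℕ.≤-reflexive (sym ([1+k]C2≡k+kC2 j))))) lt

private
  radicand-shift : ∀ m → + 2 ℤ.* ((+ 4 ℤ.+ m) ℤ.* (+ 4 ℤ.+ m)) ℤ.- + 10 ℤ.* (+ 4 ℤ.+ m) ℤ.+ + 13
                 ≡ m ℤ.* m ℤ.+ m ℤ.* m ℤ.+ + 6 ℤ.* m ℤ.+ + 5
  radicand-shift = solve-∀

  linear-shift : ∀ m d → + 2 ℤ.* (+ 4 ℤ.+ m ℤ.+ d) ℤ.- + 3 ≡ + 5 ℤ.+ + 2 ℤ.* (m ℤ.+ d)
  linear-shift = solve-∀

  square-shift : ∀ m d →
    (+ 5 ℤ.+ + 2 ℤ.* (m ℤ.+ d)) ℤ.* (+ 5 ℤ.+ + 2 ℤ.* (m ℤ.+ d))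
      ≡ + 20 ℤ.+ (+ 2 ℤ.* (m ℤ.* m) ℤ.+ + 14 ℤ.* m ℤ.+ + 4 ℤ.* (d ℤ.* d)
          ℤ.+ + 20 ℤ.* d ℤ.+ + 8 ℤ.* (m ℤ.* d))
        ℤ.+ (m ℤ.* m ℤ.+ m ℤ.* m ℤ.+ + 6 ℤ.* m ℤ.+ + 5)
  square-shift = solve-∀

  pos-2* : ∀ x → + 5 ℤ.+ + 2 ℤ.* + x ≡ + (5 + 2 * x)
  pos-2* x = cong (λ z → + 5 ℤ.+ z) (sym (ℤ.pos-* 2 x))

  pos-excess : ∀ m d →
    + 20 ℤ.+ (+ 2 ℤ.* (+ m ℤ.* + m) ℤ.+ + 14 ℤ.* + m ℤ.+ + 4 ℤ.* (+ d ℤ.* + d)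
        ℤ.+ + 20 ℤ.* + d ℤ.+ + 8 ℤ.* (+ m ℤ.* + d))
      ≡ + (20 + (2 * (m * m) + 14 * m + 4 * (d * d) + 20 * d + 8 * (m * d)))
  pos-excess m d
    rewrite sym (ℤ.pos-* m m) | sym (ℤ.pos-* d d) | sym (ℤ.pos-* m d)
          | sym (ℤ.pos-* 2 (m * m)) | sym (ℤ.pos-* 14 m) | sym (ℤ.pos-* 4 (d * d))
          | sym (ℤ.pos-* 20 d) | sym (ℤ.pos-* 8 (m * d)) = refl

  ≰x₀ : ∀ m d → ¬ (4 + m + d) ≤x₀[ 4 + m ]
  ≰x₀ m d (inj₁ a≤0)
    with subst (ℤ._≤ + 0) (trans (linear-shift (+ m) (+ d)) (pos-2* (m + d))) a≤0
  ... | ℤ.+≤+ ()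
  ≰x₀ m d (inj₂ a²≤r) = ℤ.<-irrefl refl (ℤ.<-≤-trans r<a² a²≤r)
    where
    a r s : ℤ
    a = + 2 ℤ.* + (4 + m + d) ℤ.- + 3
    r = radicand (4 + m)
    s = + m ℤ.* + m ℤ.+ + m ℤ.* + m ℤ.+ + 6 ℤ.* + m ℤ.+ + 5
    a²≡ : a ℤ.* a ≡ + suc _ ℤ.+ r
    a²≡ = trans (cong (λ z → z ℤ.* z) (linear-shift (+ m) (+ d)))
         (trans (square-shift (+ m) (+ d))
                (cong₂ ℤ._+_ (pos-excess m d) (sym (radicand-shift (+ m)))))
    r<a² : r ℤ.< a ℤ.* a
    r<a² = subst₂ ℤ._<_ (ℤ.+-identityˡ r) (sym a²≡) (ℤ.+-monoˡ-< r (ℤ.+<+ (s≤s z≤n)))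

  ≤x₀⇒< : ∀ n k → 4 ≤ n → k ≤x₀[ n ] → k < n
  ≤x₀⇒< n k 4≤n k≤x₀ = ℕ.≰⇒> λ n≤k → ≰x₀ (n ∸ 4) (k ∸ n)
    (subst₂ (λ k n → k ≤x₀[ n ])
      (trans (sym (ℕ.m+[n∸m]≡n n≤k)) (cong (_+ (k ∸ n)) (sym (ℕ.m+[n∸m]≡n 4≤n))))
      (sym (ℕ.m+[n∸m]≡n 4≤n)) k≤x₀)

  C2-mono : ∀ {i j} → i ≤ j → i C 2 ≤ j C 2
  C2-mono z≤n = z≤n
  C2-mono {suc i} {suc j} (s≤s i≤j) =
    subst₂ _≤_ (sym ([1+k]C2≡k+kC2 i)) (sym ([1+k]C2≡k+kC2 j))
      (ℕ.+-mono-≤ i≤j (C2-mono i≤j))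

k₀-isFloor : ∀ n → 4 ≤ n → IsGreatest (_≤x₀[ n ]) (k₀ n)
k₀-isFloor n 4≤n = greatest-isGreatest (_≤x₀[ n ]?) n (inj₁ ℤ.-≤+) λ j → ℕ.<⇒≤ ∘ ≤x₀⇒< n j 4≤n

-- (k₀ + 1) C 2 is an admissible number of edges for a quasi-clique of order n.
k₀-admissible : ∀ n → 4 ≤ n → 1 ≤ (k₀ n + 1) C 2 × (k₀ n + 1) C 2 ≤ n C 2
k₀-admissible n 4≤n rewrite ℕ.+-comm (k₀ n) 1 =
    C2-mono {2} (s≤s (proj₂ (k₀-isFloor n 4≤n) 1 (inj₁ ℤ.-≤+)))
  , C2-mono (≤x₀⇒< n (k₀ n) 4≤n (proj₁ (k₀-isFloor n 4≤n)))

private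
  ∈-allVecs : ∀ {A : Set} {xs : List A} → (∀ x → x ∈ xs) →
    ∀ {m} (v : Vec A m) → v ∈ allVecs xs m
  ∈-allVecs all []      = here refl
  ∈-allVecs all (x ∷ v) = ∈-cartesianProductWith⁺ _∷_ (all x) (∈-allVecs all v)

  matrix : ∀ {n} → Graph n → Vec (Vec Bool n) n
  matrix G = tabulate λ i → tabulate (adj G i)

  fromMatrix-matrix : ∀ {n} (G : Graph n) i j → adj (fromMatrix (matrix G)) i j ≡ adj G i j
  fromMatrix-matrix G i j
    rewrite lookup∘tabulate (λ i → tabulate (adj G i)) i | lookup∘tabulate (adj G i) j
          | lookup∘tabulate (λ i → tabulate (adj G i)) j | lookup∘tabulate (adj G j) i
    with Fin.<-cmp i j
  ... | tri< i<j _ j≮i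
    rewrite dec-true (i Fin.<? j) i<j | dec-false (j Fin.<? i) j≮i = Bool.∨-identityʳ _
  ... | tri> i≮j _ j<i
    rewrite dec-false (i Fin.<? j) i≮j | dec-true (j Fin.<? i) j<i = symm G j i
  ... | tri≈ i≮i refl _
    rewrite dec-false (i Fin.<? i) i≮i = sym (irrefl G i)

Λ-cong : ∀ {m n} (H : ColouredGraph m) (G G′ : Graph n) →
  (∀ i j → adj G i j ≡ adj G′ i j) → Λ H G ≡ Λ H G′
Λ-cong {m} {n} H G G′ eq = cong length (filter-≐ (isEmbedding? H G) (isEmbedding? H G′)
  ( (λ (inj , r , b) → inj , (λ i j c → trans (sym (eq _ _)) (r i j c))
                           , (λ i j c → trans (sym (eq _ _)) (b i j c)))
  , (λ (inj , r , b) → inj , (λ i j c → trans (eq _ _) (r i j c))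
                           , (λ i j c → trans (eq _ _) (b i j c))))
  (allVecs (allFin n) m))

Λmax-isMaximum : ∀ {m} (H : ColouredGraph m) n →
  (Σ[ G ∈ Graph n ] Λ H G ≡ Λmax H n) × ((G : Graph n) → Λ H G ≤ Λmax H n)
Λmax-isMaximum H n = (maximiser H n , refl) , λ G →
  subst (_≤ Λmax H n) (Λ-cong H (fromMatrix (matrix G)) G (fromMatrix-matrix G))
    (All-lookup (f[xs]≤f[argmax] {f = Λ H} (edgeless n) (allGraphs n))
      (∈-map⁺ fromMatrix (∈-allVecs (∈-allVecs bool∈) (matrix G))))
  where
  bool∈ : ∀ b → b ∈ true ∷ false ∷ []
  bool∈ true  = here refl
  bool∈ false = there (here refl)

{-
Counting incidences gives Λ H G = 2e(n(n-1) - 2e) - 8(n-1)e + 4 Σ d², with e the number of edges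
and d the degrees.  Replacing an edge uw by vw, where d(u) ≤ d(v), raises Σ d² and keeps e, so in
a maximiser the neighbourhoods are nested; then some vertex is isolated or dominating, and
deleting it leaves a nested graph.  To induct on the order one maximises the Lagrangian
value G t = Λ H G + 2te for all integers t at once: deleting an isolated vertex only shifts t, and
complementation negates it.  The dichotomy is that value G t is either smaller than the value of
some clique with isolated vertices, or equal to the optimal one and then G is of that form unless
two consecutive clique orders tie, or that the same holds for the complement of G at -t.  In the
step, the only new shape is a clique with isolated vertices and one dominating vertex; its value
is an affine interpolation between two consecutive cliques, or the clique has less than half of
the vertices and the complementary kind of clique is strictly better.  For t = 0 the optimal order
is k₀ + 1, and a tie means that radicand n is the square of 2k - 3 for some k; in that case
joining a further vertex to j vertices of the clique of order k₀ does not change Λ.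
-}
module Submission where

open import Defs
open import Data.Bool using (Bool; true; false; not; _∧_; _∨_; _xor_)
import Data.Bool.Properties as Bool
open import Data.Empty using (⊥; ⊥-elim)
open import Data.Fin as Fin using (Fin; zero; suc; toℕ; fromℕ; fromℕ<; punchIn; punchOut; _≟_)
open import Data.Fin.Patterns using (0F; 1F; 2F; 3F)
open import Data.Fin.Permutation as Perm using (Permutation′; _⟨$⟩ʳ_; _⟨$⟩ˡ_; lift₀; insert; insert-punchIn)
import Data.Fin.Properties as Fin
open import Data.Integer using (ℤ; +_; -[1+_]; 0ℤ; 1ℤ; +≤+; +<+; ∣_∣)
import Data.Integer.Properties as ℤ
open import Data.Integer.Tactic.RingSolver using (solve-∀)
open import Data.List as List using (List; []; _∷_; length; filter; cartesianProductWith; _++_)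
import Data.List.Properties as List
open import Data.Maybe using (just)
import Data.Maybe.Properties as Maybe
open import Data.Nat as ℕ using (ℕ; zero; suc; z≤n; s≤s)
open import Data.Nat.Combinatorics using (_C_)
import Data.Nat.Properties as ℕ
open import Data.Product using (_×_; _,_; Σ-syntax; ∃-syntax; proj₁; proj₂)
open import Data.Sum as Sum using (_⊎_; inj₁; inj₂)
open import Data.Vec using (Vec; []; _∷_; lookup)
open import Data.Vec.Functional using (insertAt)
open import Data.Vec.Functional.Properties using (insertAt-lookup; insertAt-punchIn)
open import Function using (_∘_; id; _⇔_; mk⇔; Injection)
open import Function.Properties.Inverse using (↔⇒↣)
open import Level using (0ℓ)
open import Relation.Binary.Definitions using (Tri; tri<; tri≈; tri>)
open import Relation.Binary.PropositionalEquality
  using (_≡_; _≢_; refl; sym; trans; cong; cong₂; subst; subst₂; module ≡-Reasoning)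
open import Relation.Nullary using (¬_; Dec; does; yes; no)
open import Relation.Nullary.Decidable
  using (dec-true; dec-false; from-yes; _×-dec_; _⊎-dec_; _→-dec_)
open import Relation.Unary using (Pred; Decidable)
import Algebra.Properties.Semiring.Sum ℤ.+-*-semiring as Σℤ
open ≡-Reasoning

-- Nestedness does not involve t and passes both to vertex deletions and to complements. The
-- dichotomy is therefore stated for all nested graphs instead of maximisers, and this is why it has
-- an alternative in which the graph is beaten by a clique. Order and multiplier enter the value of
-- a clique only through D = (n-2)(n-3) + t, and D does not change when an isolated vertex is
-- deleted. Hence optimal orders and ties are conditions on D alone: the orders l and l + 1 tie when
-- D = q l. The conclusion has to speak of G or its complement because isolated and dominating
-- vertices may alternate in a nested graph. The delicate case is such an alternation: an isolated
-- vertex is deleted, but the induction hypothesis describes the complement of what remains. That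
-- case is reduced to inequalities between the polynomials `A`, `V′` and `V̄′`, which mention no
-- graph.

-- Finite sums of integers and indicator functions

module Sums where
  open import Data.Integer using (_+_; _*_; _-_; -_; _≤_; _<_)

  ⟦_⟧ : Bool → ℤ
  ⟦ false ⟧ = 0ℤ
  ⟦ true  ⟧ = 1ℤ

  -- Opaque, so that the summand can be inferred from a sum.
  opaque
    ∑ : ∀ {n} → (Fin n → ℤ) → ℤ
    ∑ = Σℤ.sum

    ∑-zero : (f : Fin 0 → ℤ) → ∑ f ≡ 0ℤ
    ∑-zero f = refl

    ∑-suc : ∀ {n} (f : Fin (suc n) → ℤ) → ∑ f ≡ f zero + ∑ (f ∘ suc)
    ∑-suc f = refl

    ∑-cong : ∀ {n} {f g : Fin n → ℤ} → (∀ i → f i ≡ g i) → ∑ f ≡ ∑ g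
    ∑-cong = Σℤ.sum-cong-≗

    ∑-+ : ∀ {n} (f g : Fin n → ℤ) → ∑ (λ i → f i + g i) ≡ ∑ f + ∑ g
    ∑-+ = Σℤ.∑-distrib-+

    ∑-*ˡ : ∀ {n} k (f : Fin n → ℤ) → ∑ (λ i → k * f i) ≡ k * ∑ f
    ∑-*ˡ k f = sym (Σℤ.*-distribˡ-sum k f)

    ∑-*ʳ : ∀ {n} k (f : Fin n → ℤ) → ∑ (λ i → f i * k) ≡ ∑ f * k
    ∑-*ʳ k f = sym (Σℤ.*-distribʳ-sum k f)

    ∑-comm : ∀ {m n} (f : Fin m → Fin n → ℤ) → ∑ (λ i → ∑ (f i)) ≡ ∑ (λ j → ∑ λ i → f i j)
    ∑-comm = Σℤ.∑-comm

    ∑-permute : ∀ {n} (f : Fin n → ℤ) (π : Permutation′ n) → ∑ f ≡ ∑ (λ i → f (π ⟨$⟩ʳ i))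
    ∑-permute = Σℤ.sum-permute

    ∑-remove : ∀ {n} (a : Fin (suc n)) f → ∑ f ≡ f a + ∑ (f ∘ punchIn a)
    ∑-remove a f = Σℤ.sum-remove {i = a} f

    ∑-≥0 : ∀ {n} {f : Fin n → ℤ} → (∀ i → 0ℤ ≤ f i) → 0ℤ ≤ ∑ f
    ∑-≥0 {zero}  p = ℤ.≤-refl
    ∑-≥0 {suc n} p = ℤ.+-mono-≤ (p zero) (∑-≥0 (p ∘ suc))

    ∑-const : ∀ n k → ∑ {n} (λ _ → k) ≡ + n * k
    ∑-const zero    k = sym (ℤ.*-zeroˡ k)
    ∑-const (suc n) k = trans (cong (λ z → k + z) (∑-const n k)) (sym (ℤ.suc-* (+ n) k))

  ∑-- : ∀ {n} (f g : Fin n → ℤ) → ∑ (λ i → f i - g i) ≡ ∑ f - ∑ g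
  ∑-- f g = trans (∑-+ f (λ i → - g i)) (cong (λ z → ∑ f + z)
    (trans (∑-cong λ i → sym (ℤ.-1*i≡-i (g i))) (trans (∑-*ˡ (- 1ℤ) g) (ℤ.-1*i≡-i (∑ g)))))

  δ : ∀ {n} → Fin n → Fin n → ℤ
  δ i j = ⟦ does (i ≟ j) ⟧

  ∑-δ : ∀ {n} (a : Fin n) (f : Fin n → ℤ) → ∑ (λ i → δ a i * f i) ≡ f a
  ∑-δ {suc n} zero f = trans (∑-suc _) (trans
    (cong₂ _+_ (ℤ.*-identityˡ (f zero)) (trans (∑-*ˡ 0ℤ (f ∘ suc)) (ℤ.*-zeroˡ (∑ (f ∘ suc)))))
    (ℤ.+-identityʳ (f zero)))
  ∑-δ {suc n} (suc a) f = trans (∑-suc _) (trans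
    (cong₂ _+_ (ℤ.*-zeroˡ (f zero)) (∑-δ a (f ∘ suc)))
    (ℤ.+-identityˡ (f (suc a))))

  ∑-δ-1 : ∀ {n} (a : Fin n) → ∑ (δ a) ≡ 1ℤ
  ∑-δ-1 a = trans (∑-cong λ i → sym (ℤ.*-identityʳ (δ a i))) (∑-δ a (λ _ → 1ℤ))

open Sums

-- The number of embeddings as a function of the degrees

module EmbeddingCount where
  open import Data.Integer using (_+_; _*_; _-_; -_; _≤_; _<_)

  edge : ∀ {n} → Graph n → Fin n → Fin n → ℤ
  edge G i j = ⟦ adj G i j ⟧

  deg : ∀ {n} → Graph n → Fin n → ℤ
  deg {n} G i = ∑ λ j → edge G i j

  degSum degSum² : ∀ {n} → Graph n → ℤ
  degSum  {n} G = ∑ λ i → deg G i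
  degSum² {n} G = ∑ λ i → (deg G i * deg G i)

  length-filter-map : ∀ {A B : Set} {P : Pred B 0ℓ} (P? : Decidable P) (f : A → B) xs →
    length (filter P? (List.map f xs)) ≡ length (filter (P? ∘ f) xs)
  length-filter-map P? f []       = refl
  length-filter-map P? f (x ∷ xs) with does (P? (f x))
  ... | true  = cong suc (length-filter-map P? f xs)
  ... | false = length-filter-map P? f xs

  -- A general `f` in place of the identity lets the induction on n continue with `f ∘ suc`.
  length-filter-∷ : ∀ {A : Set} {n m} {P : Pred (Vec A (suc m)) 0ℓ} (P? : Decidable P)
    (f : Fin n → A) (vs : List (Vec A m)) →
    + length (filter P? (cartesianProductWith _∷_ (List.tabulate f) vs))
      ≡ ∑ λ i → (+ length (filter (P? ∘ (f i ∷_)) vs))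
  length-filter-∷ {n = zero}  P? f vs = sym (∑-zero _)
  length-filter-∷ {n = suc n} P? f vs = begin
    + length (filter P? (List.map (f zero ∷_) vs ++ rest))
      ≡⟨ cong (+_ ∘ length) (List.filter-++ P? (List.map (f zero ∷_) vs) rest) ⟩
    + length (filter P? (List.map (f zero ∷_) vs) ++ filter P? rest)
      ≡⟨ cong +_ (List.length-++ (filter P? (List.map (f zero ∷_) vs))) ⟩
    + (length (filter P? (List.map (f zero ∷_) vs)) ℕ.+ length (filter P? rest))
      ≡⟨ cong₂ (λ k l → + k + l) (length-filter-map P? (f zero ∷_) vs)
           (length-filter-∷ P? (f ∘ suc) vs) ⟩
    + length (filter (P? ∘ (f zero ∷_)) vs)
      + (∑ λ i → + length (filter (P? ∘ (f (suc i) ∷_)) vs))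
      ≡⟨ ∑-suc (λ i → + length (filter (P? ∘ (f i ∷_)) vs)) ⟨
    (∑ λ i → + length (filter (P? ∘ (f i ∷_)) vs)) ∎
    where rest = cartesianProductWith _∷_ (List.tabulate (f ∘ suc)) vs

  length-filter-[-] : ∀ {A : Set} {P : Pred A 0ℓ} (P? : Decidable P) v →
    + length (filter P? (v ∷ [])) ≡ ⟦ does (P? v) ⟧
  length-filter-[-] P? v with does (P? v)
  ... | true  = refl
  ... | false = refl

  ∑⁴ : ∀ {n} → (Fin n → Fin n → Fin n → Fin n → ℤ) → ℤ
  ∑⁴ {n} f = ∑ λ a → ∑ λ b → ∑ λ c → ∑ λ d → f a b c d

  ∑⁴-cong : ∀ {n} {f g : Fin n → Fin n → Fin n → Fin n → ℤ} →
    (∀ a b c d → f a b c d ≡ g a b c d) → ∑⁴ f ≡ ∑⁴ g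
  ∑⁴-cong e = ∑-cong λ a → ∑-cong λ b → ∑-cong λ c → ∑-cong λ d → e a b c d

  Λ-∑⁴ : ∀ {n} (G : Graph n) →
    + Λ H G ≡ ∑⁴ λ a b c d → ⟦ does (isEmbedding? H G (a ∷ b ∷ c ∷ d ∷ [])) ⟧
  Λ-∑⁴ {n} G =
    trans (length-filter-∷ P id (vecs 3)) (∑-cong λ a →
    trans (length-filter-∷ (λ v → P (a ∷ v)) id (vecs 2)) (∑-cong λ b →
    trans (length-filter-∷ (λ v → P (a ∷ b ∷ v)) id (vecs 1)) (∑-cong λ c →
    trans (length-filter-∷ (λ v → P (a ∷ b ∷ c ∷ v)) id (vecs 0)) (∑-cong λ d →
    length-filter-[-] (λ v → P (a ∷ b ∷ c ∷ d ∷ v)) []))))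
    where
    P = isEmbedding? H G
    vecs : ∀ m → List (Vec (Fin n) m)
    vecs = allVecs (List.allFin n)

  -- Each colour class of `H` is a single unordered pair of positions. This reduces the clauses of
  -- `IsEmbedding` that quantify over all i and j to one adjacency each.
  ends : ∀ (i j k l : Fin 4) → Set
  ends i j k l = (i ≡ k × j ≡ l) ⊎ (i ≡ l × j ≡ k)

  ends? : ∀ i j k l → Dec (ends i j k l)
  ends? i j k l = ((i ≟ k) ×-dec (j ≟ l)) ⊎-dec ((i ≟ l) ×-dec (j ≟ k))

  red-ends : ∀ i j → colour H i j ≡ just red → ends i j 0F 2F
  red-ends = from-yes (Fin.all? λ i → Fin.all? λ j →
    Maybe.≡-dec _≟ᶜ_ (colour H i j) (just red) →-dec ends? i j 0F 2F)

  blue-ends : ∀ i j → colour H i j ≡ just blue → ends i j 1F 3F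
  blue-ends = from-yes (Fin.all? λ i → Fin.all? λ j →
    Maybe.≡-dec _≟ᶜ_ (colour H i j) (just blue) →-dec ends? i j 1F 3F)

  module _ {n} (G : Graph n) where

    nonedge : Fin n → Fin n → ℤ
    nonedge = edge (complement G)

    edge-diag : ∀ i → edge G i i ≡ 0ℤ
    edge-diag i = cong ⟦_⟧ (irrefl G i)

    nonedge-diag : ∀ i → nonedge i i ≡ 0ℤ
    nonedge-diag i = cong ⟦_⟧ (irrefl (complement G) i)

    edge-symm : ∀ i j → edge G i j ≡ edge G j i
    edge-symm i j = cong ⟦_⟧ (symm G i j)

    edge*nonedge≡0 : ∀ i j → edge G i j * nonedge i j ≡ 0ℤ
    edge*nonedge≡0 i j with does (i ≟ j) | adj G i j
    ... | true  | true  = refl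
    ... | true  | false = refl
    ... | false | true  = refl
    ... | false | false = refl

    module _ (a b c d : Fin n) where

      private
        φ : Vec (Fin n) 4
        φ = a ∷ b ∷ c ∷ d ∷ []

      embedding⁺ : a ≢ b → a ≢ d → c ≢ b → c ≢ d → b ≢ d →
        adj G a c ≡ true → adj G b d ≡ false → IsEmbedding H G φ
      embedding⁺ ab ad cb cd bd r s =
          (λ {i} {j} → inj i j)
        , (λ i j → reds i j ∘ red-ends i j)
        , (λ i j → blues i j ∘ blue-ends i j)
        where
        ac : a ≢ c
        ac refl with () ← trans (sym r) (irrefl G a)
        inj : ∀ i j → lookup φ i ≡ lookup φ j → i ≡ j
        inj 0F 0F _ = refl
        inj 1F 1F _ = refl
        inj 2F 2F _ = refl
        inj 3F 3F _ = refl
        inj 0F 1F e = ⊥-elim (ab e)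
        inj 0F 2F e = ⊥-elim (ac e)
        inj 0F 3F e = ⊥-elim (ad e)
        inj 1F 2F e = ⊥-elim (cb (sym e))
        inj 1F 3F e = ⊥-elim (bd e)
        inj 2F 3F e = ⊥-elim (cd e)
        inj 1F 0F e = ⊥-elim (ab (sym e))
        inj 2F 0F e = ⊥-elim (ac (sym e))
        inj 3F 0F e = ⊥-elim (ad (sym e))
        inj 2F 1F e = ⊥-elim (cb e)
        inj 3F 1F e = ⊥-elim (bd (sym e))
        inj 3F 2F e = ⊥-elim (cd (sym e))
        reds : ∀ i j → ends i j 0F 2F → adj G (lookup φ i) (lookup φ j) ≡ true
        reds _ _ (inj₁ (refl , refl)) = r
        reds _ _ (inj₂ (refl , refl)) = trans (symm G c a) r
        blues : ∀ i j → ends i j 1F 3F → adj G (lookup φ i) (lookup φ j) ≡ false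
        blues _ _ (inj₁ (refl , refl)) = s
        blues _ _ (inj₂ (refl , refl)) = trans (symm G d b) s

      -- The decision is a variable, so that the case analysis never unfolds `isEmbedding?`.
      module _ (E : Dec (IsEmbedding H G φ)) where

        private
          p q : ℤ
          p = edge G a c
          q = nonedge b d

        coincident : ∀ i j → i ≢ j → lookup φ i ≡ lookup φ j → ⟦ does E ⟧ ≡ 0ℤ
        coincident i j i≢j e = cong ⟦_⟧ (dec-false E λ (inj , _) → i≢j (inj e))

        disjoint : a ≢ b → a ≢ d → c ≢ b → c ≢ d → ⟦ does E ⟧ ≡ p * q
        disjoint ab ad cb cd with adj G a c in r | b ≟ d | adj G b d in s
        ... | true  | no bd | false = cong ⟦_⟧ (dec-true E (embedding⁺ ab ad cb cd bd r s))
        ... | true  | no bd | true  = cong ⟦_⟧ (dec-false E λ (_ , _ , bl) → case (trans (sym s)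
            (bl 1F 3F refl)))
          where case : true ≢ false
                case ()
        ... | true  | yes e | _ = coincident 1F 3F (λ ()) e
        ... | false | _ | _     = cong ⟦_⟧ (dec-false E λ (_ , re , _) → case (trans (sym r)
            (re 0F 2F refl)))
          where case : false ≢ true
                case ()

        private
          vanish : ∀ k → p * q ≡ 0ℤ → p * q - k * (p * q) ≡ 0ℤ
          vanish k e = trans (cong (λ z → z - k * z) e) (cong (λ z → 0ℤ - z) (ℤ.*-zeroʳ k))
          one : ∀ z → z - 1ℤ * z ≡ 0ℤ
          one = solve-∀
          nil : ∀ z → z - 0ℤ * z ≡ z
          nil = solve-∀
          p0 : a ≡ c → p * q ≡ 0ℤ
          p0 refl = trans (cong (_* q) (edge-diag a)) (ℤ.*-zeroˡ q)
          q0 : b ≡ d → p * q ≡ 0ℤ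
          q0 refl = trans (cong (p *_) (nonedge-diag b)) (ℤ.*-zeroʳ p)

        -- Two of the coincidences a=b, a=d, c=b, c=d already force p * q to vanish,
        -- so inclusion–exclusion stops after the linear terms.
        indicator : ⟦ does E ⟧ ≡ p * q - (δ a b + δ a d + δ c b + δ c d) * (p * q)
        indicator = split (a ≟ b) (a ≟ d) (c ≟ b) (c ≟ d)
          where
          K : Dec (a ≡ b) → Dec (a ≡ d) → Dec (c ≡ b) → Dec (c ≡ d) → ℤ
          K ab ad cb cd = ⟦ does ab ⟧ + ⟦ does ad ⟧ + ⟦ does cb ⟧ + ⟦ does cd ⟧
          split : ∀ ab ad cb cd → ⟦ does E ⟧ ≡ p * q - K ab ad cb cd * (p * q)
          split (no ab) (no ad) (no cb) (no cd) = trans (disjoint ab ad cb cd) (sym (nil (p * q)))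
          split (yes e) (no _)  (no _)  (no _)  = trans (coincident 0F 1F (λ ()) e) (sym (one (p * q)))
          split (no _)  (yes e) (no _)  (no _)  = trans (coincident 0F 3F (λ ()) e) (sym (one (p * q)))
          split (no _)  (no _)  (yes e) (no _)  = trans (coincident 2F 1F (λ ()) e) (sym (one (p * q)))
          split (no _)  (no _)  (no _)  (yes e) = trans (coincident 2F 3F (λ ()) e) (sym (one (p * q)))
          split ab@(yes e) ad@(yes f) cb cd = trans (coincident 0F 1F (λ ()) e)
            (sym (vanish (K ab ad cb cd) (q0 (trans (sym e) f))))
          split ab ad cb@(yes e) cd@(yes f) = trans (coincident 2F 1F (λ ()) e)
            (sym (vanish (K ab ad cb cd) (q0 (trans (sym e) f))))
          split ab@(yes e) ad cb@(yes f) cd = trans (coincident 0F 1F (λ ()) e)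
            (sym (vanish (K ab ad cb cd) (p0 (trans e (sym f)))))
          split ab ad@(yes e) cb cd@(yes f) = trans (coincident 0F 3F (λ ()) e)
            (sym (vanish (K ab ad cb cd) (p0 (trans e (sym f)))))
          -- In the four cases above, the red or the blue pair collapses to a single vertex. Here
          -- and below, the two pairs are the same pair, which cannot be both an edge and a
          -- non-edge.
          split ab@(yes refl) ad cb cd@(yes refl) = trans (coincident 0F 1F (λ ()) refl)
            (sym (vanish (K ab ad cb cd) (edge*nonedge≡0 a c)))
          split ab ad@(yes refl) cb@(yes refl) cd = trans (coincident 0F 3F (λ ()) refl)
            (sym (vanish (K ab ad cb cd) (trans (cong (_* nonedge c a) (edge-symm a c))
                (edge*nonedge≡0 c a))))

    private
      deg′ : Fin n → ℤ
      deg′ = deg (complement G)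

      nonedge-symm : ∀ i j → nonedge i j ≡ nonedge j i
      nonedge-symm i j = cong ⟦_⟧ (symm (complement G) i j)

      ∑² : (Fin n → Fin n → ℤ) → ℤ
      ∑² f = ∑ λ i → ∑ λ j → f i j

      ∑²-cong : ∀ {f g : Fin n → Fin n → ℤ} → (∀ i j → f i j ≡ g i j) → ∑² f ≡ ∑² g
      ∑²-cong e = ∑-cong λ i → ∑-cong (e i)

      ∑²-- : ∀ f g → ∑² (λ i j → f i j - g i j) ≡ ∑² f - ∑² g
      ∑²-- f g = trans (∑-cong λ i → ∑-- (f i) (g i)) (∑-- (λ i → ∑ (f i)) (λ i → ∑ (g i)))

      ∑²-*ˡ : ∀ k f → ∑² (λ i j → k * f i j) ≡ k * ∑² f
      ∑²-*ˡ k f = trans (∑-cong λ i → ∑-*ˡ k (f i)) (∑-*ˡ k (λ i → ∑ (f i)))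

      row : ∀ a → ∑² (λ b d → δ a b * nonedge b d) ≡ deg′ a
      row a = trans (∑-cong λ b → ∑-*ˡ (δ a b) (nonedge b)) (∑-δ a deg′)

      column : ∀ a → ∑² (λ b d → δ a d * nonedge b d) ≡ deg′ a
      column a = ∑-cong λ b → trans (∑-δ a (nonedge b)) (nonedge-symm b a)

      -- With the red pair fixed, each δ selects a row or a column of the symmetric non-edge matrix,
      -- and either sum is the co-degree of a or of c.
      inner : ∀ a c → ∑² (λ b d → edge G a c * nonedge b d - (δ a b + δ a d + δ c b + δ c d) *
          (edge G a c * nonedge b d))
        ≡ edge G a c * (degSum (complement G) - (+ 2 * deg′ a + + 2 * deg′ c))
      inner a c = begin
        ∑² (λ b d → p * nonedge b d - (δ a b + δ a d + δ c b + δ c d) * (p * nonedge b d))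
          ≡⟨ ∑²-cong (λ b d → expand p (nonedge b d) (δ a b) (δ a d) (δ c b) (δ c d)) ⟩
        ∑² (λ b d → p * (nonedge b d - δ a b * nonedge b d - δ a d * nonedge b d - δ c b * nonedge b d - δ c d * nonedge b d))
          ≡⟨ ∑²-*ˡ p _ ⟩
        p * ∑² (λ b d → nonedge b d - δ a b * nonedge b d - δ a d * nonedge b d - δ c b * nonedge b d - δ c d * nonedge b d)
          ≡⟨ cong (p *_) split ⟩
        p * (degSum (complement G) - deg′ a - deg′ a - deg′ c - deg′ c)
          ≡⟨ cong (p *_) (collect (degSum (complement G)) (deg′ a) (deg′ c)) ⟩
        p * (degSum (complement G) - (+ 2 * deg′ a + + 2 * deg′ c)) ∎
        where
        p = edge G a c
        expand : ∀ p q s t u v → p * q - (s + t + u + v) * (p * q)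
          ≡ p * (q - s * q - t * q - u * q - v * q)
        expand = solve-∀
        collect : ∀ z u v → z - u - u - v - v ≡ z - (+ 2 * u + + 2 * v)
        collect = solve-∀
        split =
          trans (∑²-- (λ b d → nonedge b d - δ a b * nonedge b d - δ a d * nonedge b d - δ c b * nonedge b d) (λ b d → δ c d * nonedge b d)) (cong₂ _-_
          (trans (∑²-- (λ b d → nonedge b d - δ a b * nonedge b d - δ a d * nonedge b d) (λ b d
              → δ c b * nonedge b d)) (cong₂ _-_
          (trans (∑²-- (λ b d → nonedge b d - δ a b * nonedge b d) (λ b d → δ a d * nonedge b d))
              (cong₂ _-_
          (trans (∑²-- nonedge (λ b d → δ a b * nonedge b d)) (cong (λ z → degSum
              (complement G) - z) (row a)))
          (column a))) (row c))) (column c))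

    -- The product chooses the red and the blue pair independently. Of the four ways in which they
    -- can share a vertex, each accounts for one copy of the subtracted sum.
    Λ-deg-deg′ : + Λ H G ≡ degSum G * degSum (complement G) - + 4 * (∑ λ i → deg G i * deg′ i)
    Λ-deg-deg′ = begin
      + Λ H G
        ≡⟨ Λ-∑⁴ G ⟩
      (∑⁴ λ a b c d → ⟦ does (isEmbedding? H G (a ∷ b ∷ c ∷ d ∷ [])) ⟧)
        ≡⟨ ∑⁴-cong (λ a b c d → indicator a b c d (isEmbedding? H G (a ∷ b ∷ c ∷ d ∷ []))) ⟩
      (∑⁴ λ a b c d → edge G a c * nonedge b d - (δ a b + δ a d + δ c b + δ c d) *
          (edge G a c * nonedge b d))
        -- Exchanges b and c, so that the red pair is summed outermost.
        ≡⟨ ∑-cong (λ a → ∑-comm {n} {n} _) ⟩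
      ∑² (λ a c → ∑² λ b d → edge G a c * nonedge b d - (δ a b + δ a d + δ c b + δ c d) *
          (edge G a c * nonedge b d))
        ≡⟨ ∑²-cong inner ⟩
      ∑² (λ a c → edge G a c * (Ȳ - (+ 2 * deg′ a + + 2 * deg′ c)))
        ≡⟨ ∑²-cong (λ a c → expand (edge G a c) Ȳ (deg′ a) (deg′ c)) ⟩
      ∑² (λ a c → Ȳ * edge G a c - + 2 * (deg′ a * edge G a c) - + 2 * (edge G a c * deg′ c))
        ≡⟨ trans (∑²-- _ _) (cong₂ _-_ (trans (∑²-- _ _) (cong₂ _-_ (∑²-*ˡ Ȳ (edge G)) (∑²-*ˡ (+ 2) (λ a c → deg′ a * edge G a c)))) (∑²-*ˡ (+ 2) (λ a c → edge G a c * deg′ c))) ⟩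
      Ȳ * degSum G - + 2 * ∑² (λ a c → deg′ a * edge G a c) - + 2 * ∑² (λ a c → edge G a c * deg′ c)
        ≡⟨ cong₂ (λ u v → Ȳ * degSum G - + 2 * u - + 2 * v) rows columns ⟩
      Ȳ * degSum G - + 2 * T - + 2 * T
        ≡⟨ collect Ȳ (degSum G) T ⟩
      degSum G * Ȳ - + 4 * T ∎
      where
      Ȳ = degSum (complement G)
      T = ∑ λ i → (deg G i * deg′ i)
      rows : ∑² (λ a c → deg′ a * edge G a c) ≡ T
      rows = ∑-cong λ a → trans (∑-*ˡ (deg′ a) (edge G a)) (ℤ.*-comm (deg′ a) (deg G a))
      columns : ∑² (λ a c → edge G a c * deg′ c) ≡ T
      columns = trans (∑-comm {n} {n} (λ a c → edge G a c * deg′ c)) (∑-cong λ c →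
        trans (∑-*ʳ (deg′ c) (λ a → edge G a c)) (cong (_* deg′ c) (∑-cong λ a → edge-symm a c)))
      expand : ∀ p z u v → p * (z - (+ 2 * u + + 2 * v)) ≡ z * p - + 2 * (u * p) - + 2 * (p * v)
      expand = solve-∀
      collect : ∀ z w t → z * w - + 2 * t - + 2 * t ≡ w * z - + 4 * t
      collect = solve-∀

    deg-complement : ∀ i → deg (complement G) i ≡ + n - 1ℤ - deg G i
    deg-complement i = begin
      (∑ λ j → nonedge i j)
        ≡⟨ ∑-cong pointwise ⟩
      (∑ λ j → 1ℤ - δ i j - edge G i j)
        ≡⟨ trans (∑-- _ (edge G i)) (cong (_- deg G i) (∑-- (λ _ → 1ℤ) (δ i))) ⟩
      (∑ λ _ → 1ℤ) - ∑ (δ i) - deg G i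
        ≡⟨ cong₂ (λ u v → u - v - deg G i) (trans (∑-const n 1ℤ) (ℤ.*-identityʳ (+ n))) (∑-δ-1 i) ⟩
      + n - 1ℤ - deg G i ∎
      where
      pointwise : ∀ j → nonedge i j ≡ 1ℤ - δ i j - edge G i j
      pointwise j with i ≟ j
      ... | yes refl = cong (λ z → 0ℤ - z) (sym (edge-diag i))
      ... | no _ with adj G i j
      ...   | true  = refl
      ...   | false = refl

    degSum-complement : degSum (complement G) ≡ + n * (+ n - 1ℤ) - degSum G
    degSum-complement = trans (∑-cong deg-complement)
      (trans (∑-- (λ _ → + n - 1ℤ) (deg G)) (cong (_- degSum G) (∑-const n (+ n - 1ℤ))))

    -- Only the first two moments of the degree sequence remain. Deletions, edge shifts and
    -- isomorphisms are followed through these two sums alone.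
    Λ-deg : + Λ H G ≡ degSum G * (+ n * (+ n - 1ℤ) - degSum G) - + 4 *
        (+ n - 1ℤ) * degSum G + + 4 * degSum² G
    Λ-deg = begin
      + Λ H G
        ≡⟨ Λ-deg-deg′ ⟩
      degSum G * degSum (complement G) - + 4 * (∑ λ i → deg G i * deg′ i)
        ≡⟨ cong₂ (λ u v → degSum G * u - + 4 * v) degSum-complement
            (trans (∑-cong λ i → trans (cong (deg G i *_) (deg-complement i)) (expand (+ n - 1ℤ)
                (deg G i)))
            (trans (∑-- _ _) (cong (_- degSum² G) (∑-*ˡ (+ n - 1ℤ) (deg G))))) ⟩
      degSum G * (+ n * (+ n - 1ℤ) - degSum G) - + 4 * ((+ n - 1ℤ) * degSum G - degSum² G)
        ≡⟨ collect (degSum G * (+ n * (+ n - 1ℤ) - degSum G)) (+ n - 1ℤ) (degSum G) (degSum² G) ⟩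
      degSum G * (+ n * (+ n - 1ℤ) - degSum G) - + 4 * (+ n - 1ℤ) * degSum G + + 4 * degSum² G ∎
      where
      expand : ∀ k d → d * (k - d) ≡ k * d - d * d
      expand = solve-∀
      collect : ∀ z k u v → z - + 4 * (k * u - v) ≡ z - + 4 * k * u + + 4 * v
      collect = solve-∀

open EmbeddingCount

-- Values of cliques and their optimal orders

module CliqueValues where
  open import Data.Integer using (_+_; _*_; _-_; -_; _≤_; _<_)

  0≤+ : ∀ n → 0ℤ ≤ + n
  0≤+ n = +≤+ z≤n

  infixl 6 _⊕_
  infixl 7 _⊗_

  _⊕_ : ∀ {a b} → 0ℤ ≤ a → 0ℤ ≤ b → 0ℤ ≤ a + b
  _⊕_ = ℤ.+-mono-≤

  _⊗_ : ∀ {a b} → 0ℤ ≤ a → 0ℤ ≤ b → 0ℤ ≤ a * b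
  _⊗_ {+ m} {+ n} _ _ = subst (0ℤ ≤_) (ℤ.pos-* m n) (0≤+ (m ℕ.* n))

  0≤i² : ∀ i → 0ℤ ≤ i * i
  0≤i² (+ n)          = 0≤+ n ⊗ 0≤+ n
  0≤i² (-[1+ n ]) = +≤+ z≤n

  ≤-diff : ∀ {a b} → a ≤ b → 0ℤ ≤ b - a
  ≤-diff = ℤ.i≤j⇒0≤j-i

  diff-≤ : ∀ {a b e} → b - a ≡ e → 0ℤ ≤ e → a ≤ b
  diff-≤ eq p = ℤ.0≤i-j⇒j≤i (subst (0ℤ ≤_) (sym eq) p)

  private
    pull-1 : ∀ a b → b - a - 1ℤ ≡ b - (1ℤ + a)
    pull-1 = solve-∀

  <-diff : ∀ {a b} → a < b → 0ℤ ≤ b - a - 1ℤ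
  <-diff {a} {b} p = subst (0ℤ ≤_) (sym (pull-1 a b)) (≤-diff (ℤ.i<j⇒suc[i]≤j p))

  diff-< : ∀ {a b e} → b - a - 1ℤ ≡ e → 0ℤ ≤ e → a < b
  diff-< {a} {b} eq p = ℤ.suc[i]≤j⇒i<j (diff-≤ (trans (sym (pull-1 a b)) eq) p)

  -- A l D is Λ H K + t · degSum K for the graph K on m vertices made of a clique
  -- of order l and isolated vertices, where D = (m-2)(m-3) + t.
  A : ℤ → ℤ → ℤ
  A l D = l * (l - 1ℤ) * (D - (l - + 2) * (l - + 3))

  -- The value of D at which the cliques of order l and l + 1 tie.
  q : ℤ → ℤ
  q l = + 2 * ((l - 1ℤ) * (l - + 2))

  -- The sign is that of D - q l for positive l. As q is nondecreasing from 1 on, A is unimodal in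
  -- l.
  A-step : ∀ l D → A (1ℤ + l) D - A l D ≡ + 2 * (l * (D - q l))
  A-step = lemma
    where
    lemma : ∀ l D → (1ℤ + l) * (1ℤ + l - 1ℤ) * (D - (1ℤ + l - + 2) * (1ℤ + l - + 3))
        - l * (l - 1ℤ) * (D - (l - + 2) * (l - + 3))
      ≡ + 2 * (l * (D - + 2 * ((l - 1ℤ) * (l - + 2))))
    lemma = solve-∀

  q-mono : ∀ {j k} → 1 ℕ.≤ j → j ℕ.≤ k → q (+ j) ≤ q (+ k)

  q-mono {suc j} {suc k} _ (s≤s j≤k) = subst (λ k → q (+ suc j) ≤ q (+ suc k)) (ℕ.m+[n∸m]≡n j≤k)
      (diff-≤ (lemma (+ j) (+ (k ℕ.∸ j))) nonneg)
    where
    d = k ℕ.∸ j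
    lemma : ∀ j d → + 2 * ((1ℤ + (j + d) - 1ℤ) * (1ℤ + (j + d) - + 2)) - + 2 * ((1ℤ + j - 1ℤ) *
        (1ℤ + j - + 2))
      ≡ + 4 * (j * d) + + 2 * (d * (d - 1ℤ))
    lemma = solve-∀
    d[d-1] : ∀ d → 0ℤ ≤ + d * (+ d - 1ℤ)
    d[d-1] zero    = +≤+ z≤n
    d[d-1] (suc d) = 0≤+ (suc d) ⊗ ≤-diff {1ℤ} {+ suc d} (+≤+ (s≤s z≤n))
    nonneg = 0≤+ 4 ⊗ (0≤+ j ⊗ 0≤+ d) ⊕ 0≤+ 2 ⊗ d[d-1] d

  -- Only the last tie value on the way up has to be bounded by D: by `q-mono` it is the largest of
  -- those passed.
  A-increasing : ∀ {D} j d → 1 ℕ.≤ j → q (+ (j ℕ.+ d)) ≤ D → A (+ j) D ≤ A (+ suc (j ℕ.+ d)) D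
  A-increasing {D} j d 1≤j qD = ℤ.≤-trans (before d qD) last
    where
    last : A (+ (j ℕ.+ d)) D ≤ A (+ suc (j ℕ.+ d)) D
    last = diff-≤ (A-step (+ (j ℕ.+ d)) D) (0≤+ 2 ⊗ (0≤+ (j ℕ.+ d) ⊗ ≤-diff qD))
    before : ∀ d → q (+ (j ℕ.+ d)) ≤ D → A (+ j) D ≤ A (+ (j ℕ.+ d)) D
    before zero    _  = ℤ.≤-reflexive (cong (λ l → A (+ l) D) (sym (ℕ.+-identityʳ j)))
    before (suc d) qD rewrite ℕ.+-suc j d =
      A-increasing j d 1≤j (ℤ.≤-trans (q-mono (ℕ.≤-trans 1≤j (ℕ.m≤m+n j d)) (ℕ.n≤1+n _)) qD)

  A-decreasing : ∀ {D} l d → 1 ℕ.≤ l → D ≤ q (+ l) → A (+ (l ℕ.+ d)) D ≤ A (+ l) D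
  A-decreasing {D} l zero    1≤l Dq = ℤ.≤-reflexive (cong (λ l → A (+ l) D) (ℕ.+-identityʳ l))
  A-decreasing {D} l (suc d) 1≤l Dq rewrite ℕ.+-suc l d = ℤ.≤-trans
    (diff-≤ (trans (flip (A (+ suc (l ℕ.+ d)) D) (A (+ (l ℕ.+ d)) D))
              (trans (cong -_ (A-step (+ (l ℕ.+ d)) D)) (neg (+ (l ℕ.+ d)) D (q (+ (l ℕ.+ d))))))
      (0≤+ 2 ⊗ (0≤+ (l ℕ.+ d) ⊗ ≤-diff (ℤ.≤-trans Dq (q-mono 1≤l (ℕ.m≤m+n l d))))))
    (A-decreasing l d 1≤l Dq)
    where
    flip : ∀ a b → b - a ≡ - (a - b)
    flip = solve-∀
    neg : ∀ l D Q → - (+ 2 * (l * (D - Q))) ≡ + 2 * (l * (Q - D))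
    neg = solve-∀

  -- By A-step, l maximises A (+ l) D among 1, …, m.
  record Opt (m : ℕ) (D : ℤ) (l : ℕ) : Set where
    constructor opt
    field
      positive : 1 ℕ.≤ l
      bounded  : l ℕ.≤ m
      lower    : l ≡ 1 ⊎ ∃[ j ] (l ≡ suc j × q (+ j) ≤ D)
      upper    : l ≡ m ⊎ D ≤ q (+ l)

  open Opt

  Opt-suc : ∀ {m D l} → Opt m D l → D ≤ q (+ l) → Opt (suc m) D l
  Opt-suc o D≤ = opt (positive o) (ℕ.m≤n⇒m≤1+n (bounded o)) (lower o) (inj₂ D≤)

  -- By unimodality a new order matters only if the optimum lies at the boundary m, and then
  -- comparing D with q m decides.
  Opt-exists : ∀ m D → 1 ℕ.≤ m → ∃[ l ] Opt m D l
  Opt-exists (suc zero) D _ = 1 , opt ℕ.≤-refl ℕ.≤-refl (inj₁ refl) (inj₁ refl)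
  Opt-exists (suc m@(suc _)) D _ with Opt-exists m D (s≤s z≤n)
  ... | l , o with upper o
  ...   | inj₂ D≤   = l , Opt-suc o D≤
  ...   | inj₁ refl with ℤ.≤-total D (q (+ m))
  ...     | inj₁ D≤ = l , Opt-suc o D≤
  ...     | inj₂ ≤D = suc m , opt (s≤s z≤n) ℕ.≤-refl (inj₂ (m , refl , ≤D)) (inj₁ refl)

  Opt-maximal : ∀ {m D l} → Opt m D l → ∀ j → 1 ℕ.≤ j → j ℕ.≤ m → A (+ j) D ≤ A (+ l) D
  Opt-maximal {m} {D} {l} o j 1≤j j≤m with ℕ.<-cmp j l
  ... | tri≈ _ refl _ = ℤ.≤-refl
  ... | tri< j<l _ _ with lower o
  ...   | inj₁ refl = ⊥-elim (ℕ.<⇒≱ j<l 1≤j)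
  ...   | inj₂ (i , refl , q≤D) = subst (λ i → A (+ j) D ≤ A (+ suc i) D) (ℕ.m+[n∸m]≡n (ℕ.≤-pred j<l))
            (A-increasing j (i ℕ.∸ j) 1≤j (subst (λ i → q (+ i) ≤ D) (sym (ℕ.m+[n∸m]≡n
                (ℕ.≤-pred j<l))) q≤D))
  Opt-maximal {m} {D} {l} o j 1≤j j≤m | tri> _ _ l<j with upper o
  ...   | inj₁ refl = ⊥-elim (ℕ.<⇒≱ l<j j≤m)
  ...   | inj₂ D≤q  = subst (λ j → A (+ j) D ≤ A (+ l) D) (ℕ.m+[n∸m]≡n (ℕ.<⇒≤ l<j))
            (A-decreasing l (j ℕ.∸ l) (positive o) D≤q)

  -- Optima l < l′ give D ≤ q l ≤ q (l′ - 1) ≤ D, hence a tie at l.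
  Opt-≮ : ∀ {m D l l′} → (∀ k → 1 ℕ.≤ k → k ℕ.< m → D ≢ q (+ k)) →
    Opt m D l → Opt m D l′ → ¬ l ℕ.< l′
  Opt-≮ {l = l} noTie o o′ l<l′ with upper o | lower o′
  ... | inj₁ refl | _ = ℕ.<⇒≱ l<l′ (bounded o′)
  ... | _ | inj₁ refl = ℕ.<⇒≱ l<l′ (positive o)
  ... | inj₂ D≤q | inj₂ (j , refl , q≤D) = noTie l (positive o) (ℕ.<-≤-trans l<l′ (bounded o′))
    (ℤ.≤-antisym D≤q (ℤ.≤-trans (q-mono (positive o) (ℕ.≤-pred l<l′)) q≤D))

  Opt-unique : ∀ {m D l l′} → (∀ k → 1 ℕ.≤ k → k ℕ.< m → D ≢ q (+ k)) →
    Opt m D l → Opt m D l′ → l ≡ l′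
  Opt-unique noTie o o′ =
    ℕ.≤-antisym (ℕ.≮⇒≥ (Opt-≮ noTie o′ o)) (ℕ.≮⇒≥ (Opt-≮ noTie o o′))

open CliqueValues

-- Polynomial inequalities for adding an isolated vertex

module IsolatedVertexStep where
  open import Data.Integer using (_+_; _*_; _-_; -_; _≤_; _<_)
  open Opt

  -- E and W are the parameter and the value of the complement of a graph on M
  -- vertices.  After an isolated vertex is added to that graph, D′ and V′ are its
  -- parameter and value, and D̄′ and V̄′ those of its complement.
  D′ : ℤ → ℤ → ℤ
  D′ M E = + 2 * ((M - + 2) * (M - + 3)) - E

  V′ : ℤ → ℤ → ℤ → ℤ
  V′ M E W = W + ((M - + 2) * (M - + 3) - E) * (M * (M - 1ℤ))

  D̄′ : ℤ → ℤ → ℤ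
  D̄′ M E = E + + 4 * (M - + 2)

  V̄′ : ℤ → ℤ → ℤ → ℤ
  V̄′ M E W = W + + 2 * (M * D̄′ M E)

  -- W is a separate index so that an outcome can be transported along W = A k E. In `co-complete`
  -- and `complete` the complement of the enlarged graph, or that graph itself, may be a clique
  -- again: they correspond to an edgeless and to a complete smaller graph.
  data Outcome (M k : ℕ) (E W : ℤ) : Set where
    below       : ∀ l → 1 ℕ.≤ l → l ℕ.≤ M →
      V′ (+ M) E W < A (+ l) (D′ (+ M) E) → Outcome M k E W
    co-below    : ∀ l → 1 ℕ.≤ l → l ℕ.≤ suc M →
      V̄′ (+ M) E W < A (+ l) (D̄′ (+ M) E) → Outcome M k E W
    tie         : ∀ j → 1 ℕ.≤ j → j ℕ.≤ M → D′ (+ M) E ≡ q (+ j) →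
      V′ (+ M) E W ≡ A (+ j) (D′ (+ M) E) → Outcome M k E W
    co-tie      : ∀ j → 1 ℕ.≤ j → j ℕ.≤ M → D̄′ (+ M) E ≡ q (+ j) →
      V̄′ (+ M) E W ≡ A (+ j) (D̄′ (+ M) E) → Outcome M k E W
    co-complete : k ≡ M →
      V̄′ (+ M) E W ≡ A (+ suc M) (D̄′ (+ M) E) → Outcome M k E W
    complete    : k ≡ 1 → E < 0ℤ →
      V′ (+ M) E W ≡ A (+ M) (D′ (+ M) E) → Outcome M k E W

  private
    -- With r = M - l, T = q l - D′ M E and s = q k - E, the right-hand side is
    -- 2E(2M-2-4k) + T(6r + 4(l-2) - T) + (s-2)² + 4(Er-1) + 2Tr + 8r(r-1)(l-1),
    -- a sum of nonnegative terms as soon as E, r ≥ 1, 2k < M and l is optimal.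
    gap : ∀ l r k E →
      + 4 * (A l (D′ (l + r) E) - V′ (l + r) E (A k E))
        ≡ + 2 * (E * (+ 2 * (l + r) - + 2 - + 4 * k))
          + (q l - D′ (l + r) E) * (+ 6 * r + (+ 4 * (l - + 2) - (q l - D′ (l + r) E)))
          + (q k - E - + 2) * (q k - E - + 2)
          + + 4 * (E * r - 1ℤ) + + 2 * ((q l - D′ (l + r) E) * r) + + 8 * (r * (r - 1ℤ) * (l - 1ℤ))
    gap = lemma
      where
      lemma : ∀ l r k E →
        + 4 * (l * (l - 1ℤ) * (+ 2 * ((l + r - + 2) * (l + r - + 3)) - E - (l - + 2) * (l - + 3))
          - (k * (k - 1ℤ) * (E - (k - + 2) * (k - + 3)) + ((l + r - + 2) * (l + r - + 3) - E) *
              ((l + r) * (l + r - 1ℤ))))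
        ≡ + 2 * (E * (+ 2 * (l + r) - + 2 - + 4 * k))
          + (+ 2 * ((l - 1ℤ) * (l - + 2)) - (+ 2 * ((l + r - + 2) * (l + r - + 3)) - E)) *
              (+ 6 * r + (+ 4 * (l - + 2) - (+ 2 * ((l - 1ℤ) * (l - + 2)) - (+ 2 *
              ((l + r - + 2) * (l + r - + 3)) - E))))
          + (+ 2 * ((k - 1ℤ) * (k - + 2)) - E - + 2) * (+ 2 * ((k - 1ℤ) * (k - + 2)) - E - + 2)
          + + 4 * (E * r - 1ℤ) + + 2 * ((+ 2 * ((l - 1ℤ) * (l - + 2)) - (+ 2 * ((l + r - + 2) *
              (l + r - + 3)) - E)) * r) + + 8 * (r * (r - 1ℤ) * (l - 1ℤ))
      lemma = solve-∀

    gap-sum : ∀ l ρ {k E} → 1 ℕ.≤ l → let r = + suc ρ; T = q (+ l) - D′ (+ l + r) E in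
      0ℤ ≤ + 2 * (+ l + r) - + 2 - + 4 * k → 0ℤ < E → 0ℤ ≤ T → 0ℤ ≤ + 4 * (+ l - + 2) - T →
      0ℤ < + 4 * (A (+ l) (D′ (+ l + r) E) - V′ (+ l + r) E (A k E))
    gap-sum (suc l) ρ {k} {E} _ wide 0<E 0≤T T≤ =
      subst (0ℤ <_) (sym (gap (+ suc l) (+ suc ρ) k E)) (positive-sum ρ 0≤T T≤ wide)
      where
      0≤E-1 : 0ℤ ≤ E - 1ℤ
      0≤E-1 = subst (0ℤ ≤_) (shift E) (<-diff 0<E)
        where
        shift : ∀ E → E - 0ℤ - 1ℤ ≡ E - 1ℤ
        shift = solve-∀
      0≤E : 0ℤ ≤ E
      0≤E = ℤ.<⇒≤ 0<E
      positive-sum : ∀ ρ → let L = + suc l; r = + suc ρ; T = q L - D′ (L + r) E in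
        0ℤ ≤ T → 0ℤ ≤ + 4 * (L - + 2) - T → 0ℤ ≤ + 2 * (L + r) - + 2 - + 4 * k →
        0ℤ < + 2 * (E * (+ 2 * (L + r) - + 2 - + 4 * k))
          + T * (+ 6 * r + (+ 4 * (L - + 2) - T))
          + (q k - E - + 2) * (q k - E - + 2)
          + + 4 * (E * r - 1ℤ) + + 2 * (T * r) + + 8 * (r * (r - 1ℤ) * (L - 1ℤ))
      -- For r = 1 one has T = E, and 4(Er - 1) + 2Tr = 6(E - 1) + 2 is positive, although the first
      -- term vanishes at E = 1.
      positive-sum zero 0≤T T≤ wide = diff-<
        (rearrange (+ 2 * (E * (+ 2 * (L + 1ℤ) - + 2 - + 4 * k)))
          (T * (+ 6 * 1ℤ + (+ 4 * (L - + 2) - T))) ((q k - E - + 2) * (q k - E - + 2)) E (+ l))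
        (0≤+ 2 ⊗ (0≤E ⊗ wide) ⊕ 0≤T ⊗ (0≤+ 6 ⊕ T≤) ⊕ 0≤i² (q k - E - + 2) ⊕ 0≤+ 6 ⊗ 0≤E-1 ⊕ 0≤+ 1)
        where
        L = + suc l
        T = q L - D′ (L + 1ℤ) E
        rearrange : ∀ u v w E l → u + v + w + + 4 * (E * 1ℤ - 1ℤ)
            + + 2 * ((+ 2 * ((1ℤ + l - 1ℤ) * (1ℤ + l - + 2)) - (+ 2 * ((1ℤ + l + 1ℤ - + 2) *
                (1ℤ + l + 1ℤ - + 3)) - E)) * 1ℤ)
            + + 8 * (1ℤ * (1ℤ - 1ℤ) * (1ℤ + l - 1ℤ)) - 0ℤ - 1ℤ
          ≡ u + v + w + + 6 * (E - 1ℤ) + + 1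
        rearrange = solve-∀
      -- For r ≥ 2 the term 4(Er - 1) is at least 4 by itself.
      positive-sum (suc ρ) 0≤T T≤ wide = diff-<
        (rearrange (+ 2 * (E * (+ 2 * (L + r) - + 2 - + 4 * k)))
          (T * (+ 6 * r + (+ 4 * (L - + 2) - T))) ((q k - E - + 2) * (q k - E - + 2)) T E (+ l) (+ ρ))
        (0≤+ 2 ⊗ (0≤E ⊗ wide) ⊕ 0≤T ⊗ (0≤+ 6 ⊗ 0≤+ (suc (suc ρ)) ⊕ T≤) ⊕ 0≤i² (q k - E - + 2)
          ⊕ 0≤+ 4 ⊗ (0≤E-1 ⊗ 0≤+ (suc (suc ρ))) ⊕ 0≤+ 4 ⊗ 0≤+ ρ ⊕ 0≤+ 2 ⊗ (0≤T ⊗ 0≤+ (suc (suc ρ)))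
          ⊕ 0≤+ 8 ⊗ (0≤+ (suc (suc ρ)) ⊗ 0≤+ (suc ρ) ⊗ 0≤+ l) ⊕ 0≤+ 3)
        where
        L = + suc l
        r = + suc (suc ρ)
        T = q L - D′ (L + r) E
        rearrange : ∀ u v w T E l ρ → u + v + w + + 4 * (E * (+ 2 + ρ) - 1ℤ) + + 2 * (T * (+ 2 + ρ))
            + + 8 * ((+ 2 + ρ) * (+ 2 + ρ - 1ℤ) * (1ℤ + l - 1ℤ)) - 0ℤ - 1ℤ
          ≡ u + v + w + + 4 * ((E - 1ℤ) * (+ 2 + ρ)) + + 4 * ρ + + 2 * (T * (+ 2 + ρ))
            + + 8 * ((+ 2 + ρ) * (1ℤ + ρ) * l) + + 3
        rearrange = solve-∀

    -- Optimality of l puts D′ between q (l - 1) and q l. These differ by 4(l - 2), which yields the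
    -- bounds on T that `gap-sum` asks for. The factor 4 there, which allows the square to be
    -- completed over the integers, is cancelled at the end.
    small-clique : ∀ {M k E l} → suc (k ℕ.+ k) ℕ.≤ M → 0ℤ < E → E ≤ q (+ k) → 1 ℕ.≤ k →
      Opt M (D′ (+ M) E) l → V′ (+ M) E (A (+ k) E) < A (+ l) (D′ (+ M) E)
    small-clique {M} {suc zero} 2k<M 0<E E≤q 1≤k o = ⊥-elim (ℤ.<⇒≱ 0<E E≤q)
    small-clique {M} {suc (suc κ)} {E} {l} 2k<M 0<E E≤q 1≤k o =
      subst (λ M → V′ M E (A (+ k) E) < A (+ l) (D′ M E)) (sym M≡) (conclude
        (ℤ.*-cancelˡ-<-nonNeg (+ 4) (gap-sum l (M ℕ.∸ suc l) {+ k} {E} (positive o)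
          (subst (λ M → 0ℤ ≤ + 2 * M - + 2 - + 4 * + k) M≡ wide) 0<E
          (≤-diff (subst (λ M → D′ M E ≤ q (+ l)) M≡ D≤q))
          (subst (0ℤ ≤_) (trans (T-bound (+ l) (D′ (+ M) E)) (cong (λ M → + 4 * (+ l - + 2) - (q
              (+ l) - D′ M E)) M≡)) (≤-diff q≤D)))))
      where
      k = suc (suc κ)
      h = M ℕ.∸ suc (k ℕ.+ k)
      M≡h : + M ≡ 1ℤ + (+ k + + k) + + h
      M≡h = cong +_ (sym (ℕ.m+[n∸m]≡n 2k<M))
      wide : 0ℤ ≤ + 2 * + M - + 2 - + 4 * + k
      wide = subst (λ M → 0ℤ ≤ + 2 * M - + 2 - + 4 * + k) (sym M≡h)
        (subst (0ℤ ≤_) (lemma (+ k) (+ h)) (0≤+ 2 ⊗ 0≤+ h))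
        where
        lemma : ∀ k h → + 2 * h ≡ + 2 * (1ℤ + (k + k) + h) - + 2 - + 4 * k
        lemma = solve-∀
      -- Optimality of M > 1 would mean q (M - 1) ≤ D′, but D′ = q (M - 1) - E with E > 0.
      l≢M : l ≢ M
      l≢M refl with lower o
      ... | inj₁ refl = ℕ.<⇒≱ 2k<M (s≤s z≤n)
      ... | inj₂ (j , refl , q≤D) = ℤ.<⇒≱ 0<E (diff-≤ (lemma (+ j) E) (≤-diff q≤D))
        where
        lemma : ∀ j E → 0ℤ - E ≡ + 2 * ((1ℤ + j - + 2) * (1ℤ + j - + 3)) - E - + 2 * ((j - 1ℤ) *
            (j - + 2))
        lemma = solve-∀
      l<M : l ℕ.< M
      l<M = ℕ.≤∧≢⇒< (bounded o) l≢M
      M≡ : + M ≡ + l + + suc (M ℕ.∸ suc l)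
      M≡ = cong +_ (trans (sym (ℕ.m+[n∸m]≡n l<M)) (sym (ℕ.+-suc l _)))
      D≤q : D′ (+ M) E ≤ q (+ l)
      D≤q with upper o
      ... | inj₁ l≡M = ⊥-elim (l≢M l≡M)
      ... | inj₂ p   = p
      q≤D : q (+ l - 1ℤ) ≤ D′ (+ M) E
      q≤D with lower o
      ... | inj₂ (j , refl , q≤D) = subst (λ i → q i ≤ D′ (+ M) E) (lemma (+ j)) q≤D
        where
        lemma : ∀ j → j ≡ 1ℤ + j - 1ℤ
        lemma = solve-∀
      -- l = 1 would require D′ ≤ q 1 = 0, whereas E ≤ q k and M > 2k make D′ positive.
      ... | inj₁ refl = ⊥-elim (ℤ.<⇒≱ {0ℤ} {D′ (+ M) E} 0<D D≤q)
        where
        lemma : ∀ κ h E →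
          + 2 * ((1ℤ + (+ 2 + κ + (+ 2 + κ)) + h - + 2) * (1ℤ + (+ 2 + κ +
              (+ 2 + κ)) + h - + 3)) - E - 0ℤ - 1ℤ
          ≡ (+ 2 * ((+ 2 + κ - 1ℤ) * (+ 2 + κ - + 2)) - E)
            + (+ 6 * (κ * κ) + + 18 * κ + + 2 * (h * (+ 5 + + 4 * κ) + h * h) + + 11)
        lemma = solve-∀
        0<D : 0ℤ < D′ (+ M) E
        0<D = subst (λ M → 0ℤ < D′ M E) (sym M≡h) (diff-< (lemma (+ κ) (+ h) E)
          (≤-diff E≤q ⊕ (0≤+ 6 ⊗ 0≤i² (+ κ) ⊕ 0≤+ 18 ⊗ 0≤+ κ
            ⊕ 0≤+ 2 ⊗ (0≤+ h ⊗ (0≤+ 5 ⊕ 0≤+ 4 ⊗ 0≤+ κ) ⊕ 0≤i² (+ h)) ⊕ 0≤+ 11)))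
      T-bound : ∀ l D → D - + 2 * ((l - 1ℤ - 1ℤ) * (l - 1ℤ - + 2)) ≡ + 4 * (l - + 2) - (+ 2 *
          ((l - 1ℤ) * (l - + 2)) - D)
      T-bound = solve-∀
      conclude : ∀ {a b} → 0ℤ < b - a → a < b
      conclude {a} {b} p = diff-< (lemma a b) (<-diff p)
        where
        lemma : ∀ a b → b - a - 1ℤ ≡ b - a - 0ℤ - 1ℤ
        lemma = solve-∀

  private
    2ab-1≥0 : ∀ {a b} → 0ℤ < a → 0ℤ < b → 0ℤ ≤ + 2 * (a * b) - 1ℤ
    2ab-1≥0 {+ suc m} {+ suc n} _ _ = subst (0ℤ ≤_) (lemma (+ m) (+ n))
      (0≤+ 2 ⊗ (0≤+ m ⊗ 0≤+ n) ⊕ 0≤+ 2 ⊗ 0≤+ m ⊕ 0≤+ 2 ⊗ 0≤+ n ⊕ 0≤+ 1)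
      where
      lemma : ∀ m n → + 2 * (m * n) + + 2 * m + + 2 * n + 1ℤ ≡ + 2 * ((1ℤ + m) * (1ℤ + n)) - 1ℤ
      lemma = solve-∀
    2ab-1≥0 {+ zero} (+<+ ())
    2ab-1≥0 {+ suc m} {+ zero} _ (+<+ ())

    0<-diff : ∀ {a b} → a < b → 0ℤ < b - a
    0<-diff {a} {b} a<b = diff-< (lemma a b) (<-diff a<b)
      where
      lemma : ∀ a b → b - a - 0ℤ - 1ℤ ≡ b - a - 1ℤ
      lemma = solve-∀

    module _ (M k E : ℤ) where

      -- This difference and the next contain D̄′ - q (k + 1) with opposite signs, and the other
      -- factors are positive for k < M < 2k + 1. So away from the tie, one of the two cliques is
      -- strictly better.
      V̄′-k+1 : A (1ℤ + k) (D̄′ M E) - V̄′ M E (A k E) ≡ + 2 * ((M - k) * (q (1ℤ + k) - D̄′ M E))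
      V̄′-k+1 = lemma M k E
        where
        lemma : ∀ M k E → (1ℤ + k) * (1ℤ + k - 1ℤ) * (E + + 4 * (M - + 2) - (1ℤ + k - + 2) *
            (1ℤ + k - + 3))
            - (k * (k - 1ℤ) * (E - (k - + 2) * (k - + 3)) + + 2 * (M * (E + + 4 * (M - + 2))))
          ≡ + 2 * ((M - k) * (+ 2 * ((1ℤ + k - 1ℤ) * (1ℤ + k - + 2)) - (E + + 4 * (M - + 2))))
        lemma = solve-∀

      V̄′-k+2 : A (+ 2 + k) (D̄′ M E) - V̄′ M E (A k E) ≡ + 2 * ((1ℤ + (k + k) - M) * (D̄′ M E - q
          (1ℤ + k)))
      V̄′-k+2 = lemma M k E
        where
        lemma : ∀ M k E → (+ 2 + k) * (+ 2 + k - 1ℤ) * (E + + 4 * (M - + 2) - (+ 2 + k - + 2) *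
            (+ 2 + k - + 3))
            - (k * (k - 1ℤ) * (E - (k - + 2) * (k - + 3)) + + 2 * (M * (E + + 4 * (M - + 2))))
          ≡ + 2 * ((1ℤ + (k + k) - M) * (E + + 4 * (M - + 2) - + 2 * ((1ℤ + k - 1ℤ) * (1ℤ + k - + 2))))
        lemma = solve-∀

    -- V̄′ equals the affine interpolation, at M - k, between the values of the
    -- cliques of orders suc k (at 0) and suc (suc k) (at k + 1).
    interpolate : ∀ {M k E} → k ℕ.< M → M ℕ.< suc (k ℕ.+ k) → Outcome M k E (A (+ k) E)
    interpolate {M} {k} {E} k<M M<2k+1 with ℤ.<-cmp (D̄′ (+ M) E) (q (+ suc k))
    ... | tri< σ<0 _ _ = co-below (suc k) (s≤s z≤n) (s≤s (ℕ.<⇒≤ k<M))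
      (diff-< (cong (_- 1ℤ) (V̄′-k+1 (+ M) (+ k) E)) (2ab-1≥0 (0<-diff (+<+ k<M)) (0<-diff σ<0)))
    ... | tri> _ _ 0<σ = co-below (suc (suc k)) (s≤s z≤n) (s≤s k<M)
      (diff-< (cong (_- 1ℤ) (V̄′-k+2 (+ M) (+ k) E)) (2ab-1≥0 (0<-diff (+<+ M<2k+1)) (0<-diff 0<σ)))
    ... | tri≈ _ D̄≡q _ = co-tie (suc k) (s≤s z≤n) k<M D̄≡q
      (sym (ℤ.i-j≡0⇒i≡j _ _ (trans (V̄′-k+1 (+ M) (+ k) E)
        (trans (cong (λ z → + 2 * ((+ M - + k) * z)) (ℤ.i≡j⇒i-j≡0 (sym D̄≡q))) (zeros (+ M - + k))))))
      where
      zeros : ∀ z → + 2 * (z * 0ℤ) ≡ 0ℤ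
      zeros = solve-∀

  -- For k < M the sign of E decides. If E < 0, only k = 1 can be optimal, because q is never
  -- negative on natural numbers. If E = 0, the optimal value is 0 and D′ is the tie value q (M -
  -- 1). If E > 0, the comparison depends on whether 2k < M.
  outcome : ∀ {M k E} → Opt M E k → Outcome M k E (A (+ k) E)
  outcome {M} {k} {E} o with k ℕ.≟ M
  ... | yes refl = co-complete refl (lemma (+ M) E)
    where
    lemma : ∀ M E → M * (M - 1ℤ) * (E - (M - + 2) * (M - + 3)) + + 2 * (M * (E + + 4 * (M - + 2)))
      ≡ (1ℤ + M) * (1ℤ + M - 1ℤ) * (E + + 4 * (M - + 2) - (1ℤ + M - + 2) * (1ℤ + M - + 3))
    lemma = solve-∀
  ... | no k≢M = split (ℕ.≤∧≢⇒< (bounded o) k≢M) E≤q (lower o) (ℤ.<-cmp E 0ℤ)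
    where
    E≤q : E ≤ q (+ k)
    E≤q with upper o
    ... | inj₁ k≡M = ⊥-elim (k≢M k≡M)
    ... | inj₂ p   = p
    -- As q 3 > 0, only orders k ≤ 3 are optimal at E = 0, and for these k(k-1)(k-2)(k-3) vanishes.
    A≡0 : ∀ k → k ≡ 1 ⊎ ∃[ j ] (k ≡ suc j × q (+ j) ≤ 0ℤ) → A (+ k) 0ℤ ≡ 0ℤ
    A≡0 k (inj₁ refl) = refl
    A≡0 k (inj₂ (0 , refl , _)) = refl
    A≡0 k (inj₂ (1 , refl , _)) = refl
    A≡0 k (inj₂ (2 , refl , _)) = refl
    A≡0 k (inj₂ (suc (suc (suc j)) , refl , q≤0)) =
      ⊥-elim (ℤ.<⇒≱ {0ℤ} {q (+ 3)} (+<+ (s≤s z≤n)) (ℤ.≤-trans (q-mono {3} {3 ℕ.+ j} (s≤s z≤n)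
          (ℕ.m≤m+n 3 j)) q≤0))
    split : ∀ {M E} → k ℕ.< M → E ≤ q (+ k) → k ≡ 1 ⊎ ∃[ j ] (k ≡ suc j × q (+ j) ≤ E) →
      Tri (E < 0ℤ) (E ≡ 0ℤ) (0ℤ < E) → Outcome M k E (A (+ k) E)
    split {M} {E} k<M E≤q (inj₁ refl) (tri< E<0 _ _) = complete refl E<0 (lemma (+ M) E)
      where
      lemma : ∀ M E → 0ℤ + ((M - + 2) * (M - + 3) - E) * (M * (M - 1ℤ))
        ≡ M * (M - 1ℤ) * (+ 2 * ((M - + 2) * (M - + 3)) - E - (M - + 2) * (M - + 3))
      lemma = solve-∀
    split k<M E≤q (inj₂ (suc j , refl , q≤E)) (tri< E<0 _ _) =
      ⊥-elim (ℤ.<⇒≱ E<0 (ℤ.≤-trans (q-mono {1} {suc j} ℕ.≤-refl (s≤s z≤n)) q≤E))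
    split k<M E≤q (inj₂ (zero , refl , q≤E)) (tri< E<0 _ _) = ⊥-elim (ℤ.<⇒≱ E<0 (ℤ.≤-trans (0≤+ 4) q≤E))
    split {suc M} (s≤s k≤M) E≤q low (tri≈ _ refl _) =
      tie M (ℕ.≤-trans (positive o) k≤M) (ℕ.n≤1+n M) (lemma (+ M))
        (trans (cong (λ W → V′ (+ suc M) 0ℤ W) (A≡0 k low)) (lemma₂ (+ M)))
      where
      lemma : ∀ M → + 2 * ((1ℤ + M - + 2) * (1ℤ + M - + 3)) - 0ℤ ≡ + 2 * ((M - 1ℤ) * (M - + 2))
      lemma = solve-∀
      lemma₂ : ∀ M → 0ℤ + ((1ℤ + M - + 2) * (1ℤ + M - + 3) - 0ℤ) * ((1ℤ + M) * (1ℤ + M - 1ℤ))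
        ≡ M * (M - 1ℤ) * (+ 2 * ((1ℤ + M - + 2) * (1ℤ + M - + 3)) - 0ℤ - (M - + 2) * (M - + 3))
      lemma₂ = solve-∀
    split {M} {E} k<M E≤q low (tri> _ _ 0<E) with suc (k ℕ.+ k) ℕ.≤? M
    ... | no 2k≮M  = interpolate k<M (ℕ.≰⇒> 2k≮M)
    ... | yes 2k<M =
      let l , oₗ = Opt-exists M (D′ (+ M) E) (ℕ.≤-trans (positive o) (ℕ.<⇒≤ k<M)) in
      below l (positive oₗ) (bounded oₗ) (small-clique 2k<M 0<E E≤q (positive o) oₗ)

open IsolatedVertexStep

-- Complements, vertex deletion and nested graphs

module Graphs where
  open import Data.Integer using (_+_; _*_; _-_; -_; _≤_; _<_)

  module _ {n} (G G′ : Graph n) (e : ∀ i j → adj G i j ≡ adj G′ i j) where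

    deg-cong : ∀ i → deg G i ≡ deg G′ i
    deg-cong i = ∑-cong λ j → cong ⟦_⟧ (e i j)

    degSum-cong : degSum G ≡ degSum G′
    degSum-cong = ∑-cong deg-cong

  degSum²-complement : ∀ {n} (G : Graph n) → degSum² (complement G)
    ≡ + n * ((+ n - 1ℤ) * (+ n - 1ℤ)) - + 2 * (+ n - 1ℤ) * degSum G + degSum² G
  degSum²-complement {n} G = begin
    (∑ λ i → deg (complement G) i * deg (complement G) i)
      ≡⟨ ∑-cong (λ i → trans (cong (λ d → d * d) (deg-complement G i)) (expand (+ n - 1ℤ) (deg G i))) ⟩
    (∑ λ i → k * k - + 2 * k * deg G i + deg G i * deg G i)
      ≡⟨ trans (∑-+ _ (λ i → deg G i * deg G i)) (cong (_+ degSum² G) (∑-- (λ _ → k * k) (λ i → + 2 * k * deg G i))) ⟩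
    ∑ {n} (λ _ → k * k) - (∑ λ i → + 2 * k * deg G i) + degSum² G
      ≡⟨ cong₂ (λ u v → u - v + degSum² G) (∑-const n (k * k)) (∑-*ˡ (+ 2 * k) (deg G)) ⟩
    + n * (k * k) - + 2 * k * degSum G + degSum² G ∎
    where
    k = + n - 1ℤ
    expand : ∀ k d → (k - d) * (k - d) ≡ k * k - + 2 * k * d + d * d
    expand = solve-∀

  Λ-complement : ∀ {n} (G : Graph n) → Λ H (complement G) ≡ Λ H G
  Λ-complement {n} G = ℤ.+-injective (begin
    + Λ H (complement G)
      ≡⟨ Λ-deg (complement G) ⟩
    degSum (complement G) * (+ n * (+ n - 1ℤ) - degSum (complement G))
      - + 4 * (+ n - 1ℤ) * degSum (complement G) + + 4 * degSum² (complement G)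
      ≡⟨ cong₂ (λ X S → X * (+ n * (+ n - 1ℤ) - X) - + 4 * (+ n - 1ℤ) * X + + 4 * S) (degSum-complement G) (degSum²-complement G) ⟩
    _ ≡⟨ lemma (+ n) (degSum G) (degSum² G) ⟩
    _ ≡⟨ Λ-deg G ⟨
    + Λ H G ∎)
    where
    lemma : ∀ n X S → (n * (n - 1ℤ) - X) * (n * (n - 1ℤ) - (n * (n - 1ℤ) - X)) - + 4 * (n - 1ℤ) *
        (n * (n - 1ℤ) - X)
        + + 4 * (n * ((n - 1ℤ) * (n - 1ℤ)) - + 2 * (n - 1ℤ) * X + S)
      ≡ X * (n * (n - 1ℤ) - X) - + 4 * (n - 1ℤ) * X + + 4 * S
    lemma = solve-∀

  value : ∀ {n} → Graph n → ℤ → ℤ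
  value G t = + Λ H G + t * degSum G

  value-0 : ∀ {n} (G : Graph n) → value G 0ℤ ≡ + Λ H G
  value-0 G = trans (cong (λ z → + Λ H G + z) (ℤ.*-zeroˡ (degSum G))) (ℤ.+-identityʳ _)

  value-cong : ∀ {n} (G G′ : Graph n) → (∀ i j → adj G i j ≡ adj G′ i j) → ∀ t → value G t ≡ value G′ t
  value-cong G G′ e t = cong₂ (λ L X → + L + t * X) (Λ-cong H G G′ e) (degSum-cong G G′ e)

  value-complement : ∀ {n} (G : Graph n) t → value (complement G) (- t) ≡ value G t - t * (+ n *
      (+ n - 1ℤ))
  value-complement {n} G t = trans
    (cong₂ (λ L X → + L + - t * X) (Λ-complement G) (degSum-complement G))
    (lemma (+ Λ H G) t (+ n * (+ n - 1ℤ)) (degSum G))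
    where
    lemma : ∀ L t N X → L + - t * (N - X) ≡ L + t * X - t * N
    lemma = solve-∀

  infixl 6 _─_

  _─_ : ∀ {n} → Graph (suc n) → Fin (suc n) → Graph n
  G ─ v = record
    { adj    = λ i j → adj G (punchIn v i) (punchIn v j)
    ; symm   = λ i j → symm G (punchIn v i) (punchIn v j)
    ; irrefl = λ i → irrefl G (punchIn v i)
    }

  Isolated : ∀ {n} → Graph n → Fin n → Set
  Isolated G v = ∀ w → adj G v w ≡ false

  module _ {n} (G : Graph (suc n)) (v : Fin (suc n)) (iso : Isolated G v) where

    deg-isolated : deg G v ≡ 0ℤ
    deg-isolated = trans (∑-cong λ w → cong ⟦_⟧ (iso w)) (trans (∑-const (suc n) 0ℤ) (ℤ.*-zeroʳ
        (+ suc n)))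

    deg-─ : ∀ i → deg G (punchIn v i) ≡ deg (G ─ v) i
    deg-─ i = trans (∑-remove v (edge G (punchIn v i)))
      (trans (cong (λ b → ⟦ b ⟧ + deg (G ─ v) i) (trans (symm G _ _) (iso (punchIn v i))))
          (ℤ.+-identityˡ _))

    degSum-─ : degSum G ≡ degSum (G ─ v)
    degSum-─ = trans (∑-remove v (deg G)) (trans (cong₂ _+_ deg-isolated (∑-cong deg-─))
        (ℤ.+-identityˡ _))

    degSum²-─ : degSum² G ≡ degSum² (G ─ v)
    degSum²-─ = trans (∑-remove v (λ i → deg G i * deg G i))
      (trans (cong₂ _+_ (cong (λ d → d * d) deg-isolated) (∑-cong λ i → cong (λ d → d * d)
          (deg-─ i))) (ℤ.+-identityˡ _))

    -- The extra vertex raises n(n-1) by 2n and 4(n-1) by 4. The net 2n - 4 multiplies the degree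
    -- sum and is absorbed into t.
    value-─ : ∀ t → value G t ≡ value (G ─ v) (t + + 2 * (+ n - + 2))
    value-─ t = begin
      + Λ H G + t * degSum G
        ≡⟨ cong (_+ t * degSum G) (Λ-deg G) ⟩
      degSum G * (+ suc n * (+ suc n - 1ℤ) - degSum G) - + 4 *
          (+ suc n - 1ℤ) * degSum G + + 4 * degSum² G + t * degSum G
        ≡⟨ cong₂ (λ X S → X * (+ suc n * (+ suc n - 1ℤ) - X) - + 4 * (+ suc n - 1ℤ) * X + + 4 * S + t * X) degSum-─ degSum²-─ ⟩
      _ ≡⟨ lemma (+ n) (degSum (G ─ v)) (degSum² (G ─ v)) t ⟩
      _ ≡⟨ cong (_+ (t + + 2 * (+ n - + 2)) * degSum (G ─ v)) (Λ-deg (G ─ v)) ⟨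
      value (G ─ v) (t + + 2 * (+ n - + 2)) ∎
      where
      lemma : ∀ n X S t → X * ((1ℤ + n) * (1ℤ + n - 1ℤ) - X) - + 4 * (1ℤ + n - 1ℤ) * X + + 4 * S + t * X
        ≡ X * (n * (n - 1ℤ) - X) - + 4 * (n - 1ℤ) * X + + 4 * S + (t + + 2 * (n - + 2)) * X
      lemma = solve-∀

  -- These are the threshold graphs: neighbourhoods are linearly preordered by inclusion, and the
  -- degrees give the order.
  Nested : ∀ {n} → Graph n → Set
  Nested G = ∀ u v w → deg G u ≤ deg G v → w ≢ v → adj G u w ≡ true → adj G v w ≡ true

  Nested-─ : ∀ {n} (G : Graph (suc n)) v → Isolated G v → Nested G → Nested (G ─ v)
  Nested-─ G v iso nested a b c d≤ c≢b = nested (punchIn v a) (punchIn v b) (punchIn v c)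
    (subst₂ _≤_ (sym (deg-─ G v iso a)) (sym (deg-─ G v iso b)) d≤) (c≢b ∘ Fin.punchIn-injective v c b)

  adj-complement : ∀ {n} (G : Graph n) {i j} → i ≢ j → adj (complement G) i j ≡ not (adj G i j)
  adj-complement G {i} {j} i≢j = cong (λ b → not b ∧ not (adj G i j)) (dec-false (i ≟ j) i≢j)

  complement-complement : ∀ {n} (G : Graph n) i j → adj (complement (complement G)) i j ≡ adj G i j
  complement-complement G i j with i ≟ j
  ... | yes refl = sym (irrefl G i)
  ... | no _     = Bool.not-involutive (adj G i j)

  Nested-complement : ∀ {n} (G : Graph n) → Nested G → Nested (complement G)
  Nested-complement {n} G nested u v w d≤ w≢v adj-uw
    with adj G v w in eq
  ... | false = cong (λ b → not b ∧ true) (dec-false (v ≟ w) (w≢v ∘ sym))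
  ... | true  = ⊥-elim (clash adj-uw)
    where
    w≢u : w ≢ u
    w≢u refl with () ← trans (sym adj-uw) (irrefl (complement G) w)
    flip : ∀ k d → k - (k - d) ≡ d
    flip = solve-∀
    d≥ : deg G v ≤ deg G u
    d≥ = subst₂ _≤_ (flip (+ n - 1ℤ) (deg G v)) (flip (+ n - 1ℤ) (deg G u))
      (ℤ.+-monoʳ-≤ (+ n - 1ℤ) (ℤ.neg-mono-≤ (subst₂ _≤_ (deg-complement G u) (deg-complement G v) d≤)))
    clash : adj (complement G) u w ≡ true → ⊥
    clash p with () ← trans (sym p) (trans (adj-complement G (w≢u ∘ sym)) (cong not
        (nested v u w d≥ w≢u eq)))

  argmax-Fin : ∀ {n} (f : Fin (suc n) → ℤ) → ∃[ v ] (∀ u → f u ≤ f v)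
  argmax-Fin {zero}  f = zero , λ { zero → ℤ.≤-refl }
  argmax-Fin {suc n} f with argmax-Fin (f ∘ suc)
  ... | v , max with ℤ.≤-total (f zero) (f (suc v))
  ...   | inj₁ ≤v = suc v , λ { zero → ≤v ; (suc u) → max u }
  ...   | inj₂ v≤ = zero , λ { zero → ℤ.≤-refl ; (suc u) → ℤ.≤-trans (max u) v≤ }

  -- By nestedness, a non-neighbour of a vertex of maximum degree has no neighbours at all.
  isolated-or-dominating : ∀ {n} (G : Graph (suc n)) → Nested G →
    (∃[ v ] Isolated G v) ⊎ (∃[ v ] Isolated (complement G) v)
  isolated-or-dominating {n} G nested with argmax-Fin (deg G)
  ... | v , max with Fin.all? (λ w → adj (complement G) v w Bool.≟ false)
  ...   | yes dom = inj₂ (v , dom)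
  ...   | no ¬dom with Fin.¬∀⟶∃¬ (suc n) _ (λ w → adj (complement G) v w Bool.≟ false) ¬dom
  ...     | w , vw = inj₁ (w , λ u → Bool.¬-not λ wu → nonadjacent (nested u v w (max u) w≢v
      (trans (symm G u w) wu)))
    where
    w≢v : w ≢ v
    w≢v refl = vw (irrefl (complement G) v)
    nonadjacent : adj G v w ≢ true
    nonadjacent e = vw (trans (adj-complement G (w≢v ∘ sym)) (cong not e))

open Graphs

-- Cliques with isolated vertices

module Cliques where
  open import Data.Integer using (_+_; _*_; _-_; -_; _≤_; _<_)
  open Opt

  -- The vertices outside the clique are isolated.
  record IsClique {n} (G : Graph n) (l : ℕ) : Set where
    field
      member   : Fin n → Bool
      size     : ∑ (λ i → ⟦ member i ⟧) ≡ + l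
      adjacent : ∀ i j → adj G i j ≡ member i ∧ member j ∧ not (does (i ≟ j))

  open IsClique

  ⟦⟧-∧ : ∀ a b → ⟦ a ∧ b ⟧ ≡ ⟦ a ⟧ * ⟦ b ⟧
  ⟦⟧-∧ true  b = sym (ℤ.*-identityˡ ⟦ b ⟧)
  ⟦⟧-∧ false b = refl

  ⟦⟧-not : ∀ b → ⟦ not b ⟧ ≡ 1ℤ - ⟦ b ⟧
  ⟦⟧-not true  = refl
  ⟦⟧-not false = refl

  ⟦⟧≥0 : ∀ b → 0ℤ ≤ ⟦ b ⟧
  ⟦⟧≥0 true  = 0≤+ 1
  ⟦⟧≥0 false = 0≤+ 0

  D : ℕ → ℤ → ℤ
  D m t = (+ m - + 2) * (+ m - + 3) + t

  module _ {n} {G : Graph n} {l} (K : IsClique G l) where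
    private
      S : Fin n → ℤ
      S i = ⟦ member K i ⟧

    deg-clique : ∀ i → deg G i ≡ S i * (+ l - 1ℤ)
    deg-clique i = begin
      (∑ λ j → edge G i j)
        ≡⟨ ∑-cong (λ j → begin
             ⟦ adj G i j ⟧
               ≡⟨ cong ⟦_⟧ (adjacent K i j) ⟩
             ⟦ member K i ∧ member K j ∧ not (does (i ≟ j)) ⟧
               ≡⟨ trans (⟦⟧-∧ (member K i) _) (cong (S i *_) (trans (⟦⟧-∧ (member K j) _) (cong (S j *_) (⟦⟧-not (does (i ≟ j)))))) ⟩
             S i * (S j * (1ℤ - δ i j))
               ≡⟨ expand (S i) (S j) (δ i j) ⟩
             S i * (S j - δ i j * S j) ∎) ⟩
      (∑ λ j → S i * (S j - δ i j * S j))
        ≡⟨ trans (∑-*ˡ (S i) (λ j → S j - δ i j * S j)) (cong (S i *_) (∑-- S (λ j → δ i j * S j))) ⟩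
      S i * (∑ S - ∑ (λ j → δ i j * S j))
        ≡⟨ cong₂ (λ u v → S i * (u - v)) (size K) (∑-δ i S) ⟩
      S i * (+ l - S i)
        ≡⟨ absorb (member K i) (+ l) ⟩
      S i * (+ l - 1ℤ) ∎
      where
      expand : ∀ s t d → s * (t * (1ℤ - d)) ≡ s * (t - d * t)
      expand = solve-∀
      absorb : ∀ b l → ⟦ b ⟧ * (l - ⟦ b ⟧) ≡ ⟦ b ⟧ * (l - 1ℤ)
      absorb true  l = refl
      absorb false l = refl

    degSum-clique : degSum G ≡ + l * (+ l - 1ℤ)
    degSum-clique = trans (∑-cong deg-clique) (trans (∑-*ʳ (+ l - 1ℤ) S) (cong (_* (+ l - 1ℤ))
        (size K)))

    degSum²-clique : degSum² G ≡ + l * ((+ l - 1ℤ) * (+ l - 1ℤ))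
    degSum²-clique = trans (∑-cong λ i → trans (cong (λ d → d * d) (deg-clique i)) (square
        (member K i) (+ l - 1ℤ)))
      (trans (∑-*ʳ ((+ l - 1ℤ) * (+ l - 1ℤ)) S) (cong (_* ((+ l - 1ℤ) * (+ l - 1ℤ))) (size K)))
      where
      square : ∀ b k → ⟦ b ⟧ * k * (⟦ b ⟧ * k) ≡ ⟦ b ⟧ * (k * k)
      square true  k = trans (cong (λ z → z * z) (ℤ.*-identityˡ k)) (sym (ℤ.*-identityˡ (k * k)))
      square false k = refl

    value-clique : ∀ t → value G t ≡ A (+ l) (D n t)
    value-clique t = trans (cong (_+ t * degSum G) (Λ-deg G))
      (trans (cong₂ (λ X S → X * (+ n * (+ n - 1ℤ) - X) - + 4 *
          (+ n - 1ℤ) * X + + 4 * S + t * X) degSum-clique degSum²-clique)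
        (lemma (+ n) (+ l) t))
      where
      lemma : ∀ n l t → l * (l - 1ℤ) * (n * (n - 1ℤ) - l * (l - 1ℤ)) - + 4 * (n - 1ℤ) * (l * (l - 1ℤ))
          + + 4 * (l * ((l - 1ℤ) * (l - 1ℤ))) + t * (l * (l - 1ℤ))
        ≡ l * (l - 1ℤ) * ((n - + 2) * (n - + 3) + t - (l - + 2) * (l - + 3))
      lemma = solve-∀

    IsClique-cong : ∀ {G′ : Graph n} → (∀ i j → adj G i j ≡ adj G′ i j) → IsClique G′ l
    IsClique-cong e = record { member = member K ; size = size K ; adjacent = λ i j → trans (sym
        (e i j)) (adjacent K i j) }

  complete⇒IsClique : ∀ {n} (G : Graph n) → (∀ i j → i ≢ j → adj G i j ≡ true) → IsClique G n
  complete⇒IsClique {n} G e = record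
    { member = λ _ → true
    ; size = trans (∑-const n 1ℤ) (ℤ.*-identityʳ (+ n))
    ; adjacent = λ i j → go i j }
    where
    go : ∀ i j → adj G i j ≡ not (does (i ≟ j))
    go i j with i ≟ j
    ... | yes refl = irrefl G i
    ... | no i≢j   = e i j i≢j

  punchIn-view : ∀ {n} (v i : Fin (suc n)) → i ≡ v ⊎ ∃[ j ] i ≡ punchIn v j
  punchIn-view v i with v ≟ i
  ... | yes e = inj₁ (sym e)
  ... | no v≢i = inj₂ (punchOut v≢i , sym (Fin.punchIn-punchOut v≢i))

  does-punchIn : ∀ {n} (v : Fin (suc n)) i j → does (punchIn v i ≟ punchIn v j) ≡ does (i ≟ j)
  does-punchIn v i j with i ≟ j
  ... | yes refl = dec-true (punchIn v i ≟ punchIn v i) refl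
  ... | no i≢j   = dec-false (punchIn v i ≟ punchIn v j) (i≢j ∘ Fin.punchIn-injective v i j)

  module _ {n} (G : Graph (suc n)) (v : Fin (suc n)) (iso : Isolated G v) where

    isolatedʳ : ∀ w → adj G w v ≡ false
    isolatedʳ w = trans (symm G w v) (iso w)

    IsClique-extend : ∀ {l} → IsClique (G ─ v) l → IsClique G l
    IsClique-extend {l} K = record { member = S ; size = size′ ; adjacent = adjacent′ }
      where
      S : Fin (suc n) → Bool
      S = insertAt (member K) v false
      S-v : S v ≡ false
      S-v = insertAt-lookup (member K) v false
      S-in : ∀ i → S (punchIn v i) ≡ member K i
      S-in = insertAt-punchIn (member K) v false
      size′ : ∑ (λ i → ⟦ S i ⟧) ≡ + l
      size′ = trans (∑-remove v (λ i → ⟦ S i ⟧)) (trans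
        (cong₂ _+_ (cong ⟦_⟧ S-v) (trans (∑-cong λ i → cong ⟦_⟧ (S-in i)) (size K)))
            (ℤ.+-identityˡ (+ l)))
      adjacent′ : ∀ i j → adj G i j ≡ S i ∧ S j ∧ not (does (i ≟ j))
      adjacent′ i j with punchIn-view v i | punchIn-view v j
      ... | inj₁ refl | _ = trans (iso j) (sym (cong (_∧ (S j ∧ not (does (i ≟ j)))) S-v))
      ... | inj₂ _ | inj₁ refl = trans (isolatedʳ i) (sym (trans (cong (λ b → S i ∧ b ∧ not (does
          (i ≟ j))) S-v) (Bool.∧-zeroʳ (S i))))
      ... | inj₂ (i , refl) | inj₂ (j , refl) = trans (adjacent K i j)
        (sym (cong₂ _∧_ (S-in i) (cong₂ _∧_ (S-in j) (cong not (does-punchIn v i j)))))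

  two-members : ∀ {n} (S : Fin n → Bool) i j → i ≢ j → S i ≡ true → S j ≡ true → + 2 ≤ ∑ (λ k → ⟦ S k ⟧)
  two-members {n} S i j i≢j Si Sj = subst (_≤ ∑ (λ k → ⟦ S k ⟧)) two
    (diff-≤ (sym (∑-- (λ k → ⟦ S k ⟧) (λ k → δ i k + δ j k))) (∑-≥0 pointwise))
    where
    two : ∑ (λ k → δ i k + δ j k) ≡ + 2
    two = trans (∑-+ (δ i) (δ j)) (cong₂ _+_ (∑-δ-1 i) (∑-δ-1 j))
    pointwise : ∀ k → 0ℤ ≤ ⟦ S k ⟧ - (δ i k + δ j k)
    pointwise k with i ≟ k | j ≟ k
    ... | yes refl | yes refl = ⊥-elim (i≢j refl)
    ... | yes refl | no _ rewrite Si = +≤+ z≤n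
    ... | no _ | yes refl rewrite Sj = +≤+ z≤n
    ... | no _ | no _ = subst (0ℤ ≤_) (sym (ℤ.+-identityʳ ⟦ S k ⟧)) (⟦⟧≥0 (S k))

  -- For a missing i the function 1 - S - δ i is nonnegative, and its sum shows that S has fewer
  -- than n members.
  all-members : ∀ {n} (S : Fin n → Bool) → ∑ (λ k → ⟦ S k ⟧) ≡ + n → ∀ i → S i ≡ true
  all-members {n} S full i with S i in Si
  ... | true  = refl
  ... | false = ⊥-elim (ℤ.<-irrefl {+ n} refl (subst (_< + n) full
    (diff-< {∑ (λ k → ⟦ S k ⟧)} {+ n} (trans (cong₂ (λ u v → u - ∑ (λ k → ⟦ S k ⟧) - v) (sym
        (trans (∑-const n 1ℤ) (ℤ.*-identityʳ (+ n)))) (sym (∑-δ-1 i)))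
      (trans (cong (_- ∑ (δ i)) (sym (∑-- (λ _ → 1ℤ) (λ k → ⟦ S k ⟧)))) (sym (∑-- (λ k
          → 1ℤ - ⟦ S k ⟧) (δ i)))))
      (∑-≥0 pointwise))))
    where
    pointwise : ∀ k → 0ℤ ≤ 1ℤ - ⟦ S k ⟧ - δ i k
    pointwise k with i ≟ k
    ... | yes refl rewrite Si = +≤+ z≤n
    ... | no _ with S k
    ...   | true = +≤+ z≤n
    ...   | false = +≤+ z≤n

  IsClique-1 : ∀ {n} {G : Graph n} → IsClique G 1 → ∀ i j → adj G i j ≡ false
  IsClique-1 {G = G} K i j with i ≟ j
  ... | yes refl = irrefl G i
  ... | no i≢j with member K i in Si | member K j in Sj | adjacent K i j
  ...   | true  | true  | _ with +≤+ (s≤s ()) ← subst (+ 2 ≤_) (size K) (two-members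
      (member K) i j i≢j Si Sj)
  ...   | true  | false | e = e
  ...   | false | _     | e = e

  module _ {n} (G : Graph (suc n)) (v : Fin (suc n)) (iso : Isolated G v) where

    -- Serves the outcome `complete`: an edgeless complement makes `G ─ v` complete, and v is the
    -- isolated vertex beside it.
    IsClique-co-singleton : IsClique (complement (G ─ v)) 1 → IsClique G n
    IsClique-co-singleton K = IsClique-extend G v iso (complete⇒IsClique (G ─ v) λ i j i≢j →
      trans (sym (complement-complement (G ─ v) i j))
        (trans (adj-complement (complement (G ─ v)) i≢j) (cong not (IsClique-1 K i j))))

    -- Serves the outcome `co-complete`: if the complement of `G ─ v` is complete, then neither
    -- `G ─ v` nor G has an edge.
    IsClique-co-all : IsClique (complement (G ─ v)) n → IsClique (complement G) (suc n)
    IsClique-co-all K = complete⇒IsClique (complement G) λ i j i≢j → trans (adj-complement G i≢j)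
        (cong not (nonadjacent i j))
      where
      all = all-members (member K) (size K)
      nonadjacent : ∀ i j → adj G i j ≡ false
      nonadjacent i j with punchIn-view v i | punchIn-view v j
      ... | inj₁ refl | _ = iso j
      ... | inj₂ _ | inj₁ refl = isolatedʳ G v iso i
      ... | inj₂ (i , refl) | inj₂ (j , refl) with i ≟ j
      ...   | yes refl = irrefl (G ─ v) i
      ...   | no i≢j = trans (sym (complement-complement (G ─ v) i j)) (trans (adj-complement
          (complement (G ─ v)) i≢j)
        (cong not (trans (adjacent K i j) (cong₂ _∧_ (all i) (cong₂ _∧_ (all j) (cong not
            (dec-false (i ≟ j) i≢j)))))))

open Cliques

-- The dichotomy for nested graphs

module Dichotomy where
  open import Data.Integer using (_+_; _*_; _-_; -_; _≤_; _<_)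
  open Opt

  -- `below` accepts any better order, optimal or not, so that strict inequalities pass up the
  -- induction as they are. `tie` keeps the value and no structure, since at a tie graphs of other
  -- shapes can attain it.
  data Side {n} (G : Graph n) (t : ℤ) : Set where
    below  : ∀ l → 1 ℕ.≤ l → l ℕ.≤ n → value G t < A (+ l) (D n t) → Side G t
    clique : ∀ l → IsClique G l → Opt n (D n t) l → Side G t
    tie    : ∀ k → 1 ℕ.≤ k → k ℕ.< n → D n t ≡ q (+ k) → value G t ≡ A (+ k) (D n t) → Side G t

  Side-cong : ∀ {n} (G G′ : Graph n) → (∀ i j → adj G i j ≡ adj G′ i j) → ∀ {t} → Side G t → Side G′ t
  Side-cong {n} G G′ e {t} (below l 1≤l l≤n lt) =
    below l 1≤l l≤n (subst (_< A (+ l) (D n t)) (value-cong G G′ e t) lt)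
  Side-cong G G′ e (clique l K o) = clique l (IsClique-cong K e) o
  Side-cong G G′ e {t} (tie k 1≤k k<n D≡ eq) = tie k 1≤k k<n D≡ (trans (sym (value-cong G G′ e t)) eq)

  ≤-<-connex : ∀ a b → a ≤ b ⊎ b < a
  ≤-<-connex a b with a ℤ.≤? b
  ... | yes p = inj₁ p
  ... | no p  = inj₂ (ℤ.≰⇒> p)

  private
    A-step-pos : ∀ {l D} → 1 ℕ.≤ l → q (+ l) < D → A (+ l) D < A (+ suc l) D
    A-step-pos {suc l} {D} _ q<D = diff-< (trans (cong (_- 1ℤ) (A-step (+ suc l) D)) (lemma
        (+ l) D (q (+ suc l))))
      (0≤+ 2 ⊗ (0≤+ (suc l) ⊗ <-diff q<D) ⊕ (0≤+ 1 ⊕ 0≤+ 2 ⊗ 0≤+ l))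
      where
      lemma : ∀ l D Q → + 2 * ((1ℤ + l) * (D - Q)) - 1ℤ ≡ + 2 * ((1ℤ + l) * (D - Q - 1ℤ)) +
          (1ℤ + + 2 * l)
      lemma = solve-∀

    A-step-neg : ∀ {l D} → 1 ℕ.≤ l → D < q (+ l) → A (+ suc l) D < A (+ l) D
    A-step-neg {suc l} {D} _ D<q = diff-< (trans (flip (A (+ suc (suc l)) D) (A (+ suc l) D))
        (trans (cong (λ z → - z - 1ℤ) (A-step (+ suc l) D)) (lemma (+ l) D (q (+ suc l)))))
      (0≤+ 2 ⊗ (0≤+ (suc l) ⊗ <-diff D<q) ⊕ (0≤+ 1 ⊕ 0≤+ 2 ⊗ 0≤+ l))
      where
      flip : ∀ a b → b - a - 1ℤ ≡ - (a - b) - 1ℤ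
      flip = solve-∀
      lemma : ∀ l D Q → - (+ 2 * ((1ℤ + l) * (D - Q))) - 1ℤ ≡ + 2 * ((1ℤ + l) * (Q - D - 1ℤ)) +
          (1ℤ + + 2 * l)
      lemma = solve-∀

  -- If one of the two optimality conditions fails, `A-step` shows that the neighbouring order l + 1
  -- or l - 1 is strictly better.
  clique-Side : ∀ {n} {G : Graph n} {l t} → IsClique G l → 1 ℕ.≤ l → l ℕ.≤ n → Side G t
  clique-Side {n} {G} {l} {t} K 1≤l l≤n = low (ℕ.m≤n⇒m<n∨m≡n l≤n)
    where
    below-clique : ∀ j → 1 ℕ.≤ j → j ℕ.≤ n → A (+ l) (D n t) < A (+ j) (D n t) → Side G t
    below-clique j 1≤j j≤n lt = below j 1≤j j≤n (subst (_< A (+ j) (D n t)) (sym (value-clique K t)) lt)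
    up : l ≡ n ⊎ D n t ≤ q (+ l) → ∀ l′ → l ≡ suc l′ → Side G t
    up u zero    refl = clique _ K (opt 1≤l l≤n (inj₁ refl) u)
    up u (suc l′) refl with ≤-<-connex (q (+ suc l′)) (D n t)
    ... | inj₁ q≤D = clique _ K (opt 1≤l l≤n (inj₂ (suc l′ , refl , q≤D)) u)
    ... | inj₂ D<q = below-clique (suc l′) (s≤s z≤n) (ℕ.≤-trans (ℕ.n≤1+n _) l≤n)
        (A-step-neg {suc l′} (s≤s z≤n) D<q)
    low : l ℕ.< n ⊎ l ≡ n → Side G t
    low (inj₂ l≡n) = up (inj₁ l≡n) (ℕ.pred l) (sym (ℕ.suc-pred l {{ℕ.>-nonZero 1≤l}}))
    low (inj₁ l<n) with ≤-<-connex (D n t) (q (+ l))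
    ... | inj₁ D≤q = up (inj₂ D≤q) (ℕ.pred l) (sym (ℕ.suc-pred l {{ℕ.>-nonZero 1≤l}}))
    ... | inj₂ q<D = below-clique (suc l) (s≤s z≤n) l<n (A-step-pos {l} 1≤l q<D)

  tie-Opt : ∀ {m k E} → 1 ℕ.≤ k → k ℕ.≤ m → E ≡ q (+ k) → Opt m E k
  tie-Opt {k = suc zero}    1≤k k≤m refl = opt 1≤k k≤m (inj₁ refl) (inj₂ ℤ.≤-refl)
  tie-Opt {k = suc (suc k)} 1≤k k≤m refl =
    opt 1≤k k≤m (inj₂ (suc k , refl , q-mono (s≤s z≤n) (ℕ.n≤1+n (suc k)))) (inj₂ ℤ.≤-refl)

  module Step {M} (1≤M : 1 ℕ.≤ M) (G : Graph (suc M)) (v : Fin (suc M)) (iso : Isolated G v)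
      (t : ℤ) where

    t′ E W : ℤ
    t′ = t + + 2 * (+ M - + 2)
    E = D M (- t′)
    W = value (complement (G ─ v)) (- t′)

    D-─ : D M t′ ≡ D (suc M) t
    D-─ = lemma (+ M) t
      where
      lemma : ∀ M t → (M - + 2) * (M - + 3) + (t + + 2 * (M - + 2)) ≡ (1ℤ + M - + 2) *
          (1ℤ + M - + 3) + t
      lemma = solve-∀

    D≡D′ : D (suc M) t ≡ D′ (+ M) E
    D≡D′ = lemma (+ M) t
      where
      lemma : ∀ M t → (1ℤ + M - + 2) * (1ℤ + M - + 3) + t
        ≡ + 2 * ((M - + 2) * (M - + 3)) - ((M - + 2) * (M - + 3) + - (t + + 2 * (M - + 2)))
      lemma = solve-∀

    D≡D̄′ : D (suc M) (- t) ≡ D̄′ (+ M) E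
    D≡D̄′ = lemma (+ M) t
      where
      lemma : ∀ M t → (1ℤ + M - + 2) * (1ℤ + M - + 3) + - t
        ≡ (M - + 2) * (M - + 3) + - (t + + 2 * (M - + 2)) + + 4 * (M - + 2)
      lemma = solve-∀

    value≡V′ : value G t ≡ V′ (+ M) E W
    value≡V′ = trans (value-─ G v iso t) (trans
      (lemma (+ M) t′ (value (G ─ v) t′))
      (cong (λ w → V′ (+ M) E w) (sym (value-complement (G ─ v) t′))))
      where
      lemma : ∀ M s w → w ≡ w - s * (M * (M - 1ℤ)) + ((M - + 2) * (M - + 3) - ((M - + 2) *
          (M - + 3) + - s)) * (M * (M - 1ℤ))
      lemma = solve-∀

    value≡V̄′ : value (complement G) (- t) ≡ V̄′ (+ M) E W
    value≡V̄′ = trans (value-complement G t) (trans (cong (_- t * (+ suc M * (+ suc M - 1ℤ)))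
        (value-─ G v iso t)) (trans
      (lemma (+ M) t (value (G ─ v) t′))
      (cong (λ w → V̄′ (+ M) E w) (sym (value-complement (G ─ v) t′)))))
      where
      lemma : ∀ M t w → w - t * ((1ℤ + M) * (1ℤ + M - 1ℤ))
        ≡ w - (t + + 2 * (M - + 2)) * (M * (M - 1ℤ)) + + 2 * (M * ((M - + 2) * (M - + 3) + -
            (t + + 2 * (M - + 2)) + + 4 * (M - + 2)))
      lemma = solve-∀

    below′ : ∀ l → 1 ℕ.≤ l → l ℕ.≤ suc M → V′ (+ M) E W < A (+ l) (D′ (+ M) E) → Side G t
    below′ l 1≤l l≤ lt = below l 1≤l l≤ (subst₂ _<_ (sym value≡V′) (cong (A (+ l)) (sym D≡D′)) lt)

    co-below′ : ∀ l → 1 ℕ.≤ l → l ℕ.≤ suc M → V̄′ (+ M) E W < A (+ l) (D̄′ (+ M) E) → Side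
        (complement G) (- t)
    co-below′ l 1≤l l≤ lt = below l 1≤l l≤ (subst₂ _<_ (sym value≡V̄′) (cong (A (+ l)) (sym D≡D̄′)) lt)

    -- Value and D agree for the two graphs, so `below` and `tie` carry over. A clique has to be
    -- examined again, because the added vertex makes one more order available.
    from-─ : Side (G ─ v) t′ → Side G t
    from-─ (below l 1≤l l≤M lt) = below l 1≤l (ℕ.m≤n⇒m≤1+n l≤M)
      (subst₂ _<_ (sym (value-─ G v iso t)) (cong (A (+ l)) D-─) lt)
    from-─ (clique l K o) = clique-Side (IsClique-extend G v iso K) (positive o) (ℕ.m≤n⇒m≤1+n
        (bounded o))
    from-─ (tie k 1≤k k<M D≡ eq) = tie k 1≤k (ℕ.m<n⇒m<1+n k<M) (trans (sym D-─) D≡)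
      (trans (value-─ G v iso t) (trans eq (cong (A (+ k)) D-─)))

    Sides : Set
    Sides = Side G t ⊎ Side (complement G) (- t)

    -- V′ and V̄′ increase with the value, so each outcome at A k E is undercut.
    strictly : ∀ {k} → Opt M E k → W < A (+ k) E → Sides
    strictly {k} o lt = go (outcome o)
      where
      V′< : V′ (+ M) E W < V′ (+ M) E (A (+ k) E)
      V′< = ℤ.+-monoˡ-< (((+ M - + 2) * (+ M - + 3) - E) * (+ M * (+ M - 1ℤ))) lt
      V̄′< : V̄′ (+ M) E W < V̄′ (+ M) E (A (+ k) E)
      V̄′< = ℤ.+-monoˡ-< (+ 2 * (+ M * D̄′ (+ M) E)) lt
      go : Outcome M k E (A (+ k) E) → Sides
      go (below l 1≤l l≤M lt)      = inj₁ (below′ l 1≤l (ℕ.m≤n⇒m≤1+n l≤M) (ℤ.<-trans V′< lt))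
      go (co-below l 1≤l l≤ lt)    = inj₂ (co-below′ l 1≤l l≤ (ℤ.<-trans V̄′< lt))
      go (tie j 1≤j j≤M _ eq)      = inj₁ (below′ j 1≤j (ℕ.m≤n⇒m≤1+n j≤M) (subst (V′
          (+ M) E W <_) eq V′<))
      go (co-tie j 1≤j j≤M _ eq)   = inj₂ (co-below′ j 1≤j (ℕ.m≤n⇒m≤1+n j≤M) (subst (V̄′
          (+ M) E W <_) eq V̄′<))
      go (co-complete _ eq)        = inj₂ (co-below′ (suc M) (s≤s z≤n) ℕ.≤-refl (subst (V̄′
          (+ M) E W <_) eq V̄′<))
      go (complete _ _ eq)         = inj₁ (below′ M 1≤M (ℕ.n≤1+n M) (subst (V′ (+ M) E W <_) eq V′<))

    -- The value does not determine the graph, so the two outcomes that need its structure are left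
    -- to the caller. A clique provides it; for a tie they are impossible, because then k < M and E
    -- = q k ≥ 0.
    tightly : ∀ {k} → Opt M E k → W ≡ A (+ k) E →
      (k ≡ M → Side (complement G) (- t)) → (k ≡ 1 → E < 0ℤ → Side G t) → Sides
    tightly {k} o eq all single = go (subst (Outcome M k E) (sym eq) (outcome o))
      where
      go : Outcome M k E W → Sides
      go (below l 1≤l l≤M lt)    = inj₁ (below′ l 1≤l (ℕ.m≤n⇒m≤1+n l≤M) lt)
      go (co-below l 1≤l l≤ lt)  = inj₂ (co-below′ l 1≤l l≤ lt)
      go (tie j 1≤j j≤M D≡ eq)   = inj₁ (tie j 1≤j (s≤s j≤M) (trans D≡D′ D≡)
        (trans value≡V′ (trans eq (cong (A (+ j)) (sym D≡D′)))))
      go (co-tie j 1≤j j≤M D≡ eq) = inj₂ (tie j 1≤j (s≤s j≤M) (trans D≡D̄′ D≡)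
        (trans value≡V̄′ (trans eq (cong (A (+ j)) (sym D≡D̄′)))))
      go (co-complete k≡M _)     = inj₂ (all k≡M)
      go (complete k≡1 E<0 _)    = inj₁ (single k≡1 E<0)

    from-co-─ : Side (complement (G ─ v)) (- t′) → Sides
    from-co-─ (below l 1≤l l≤M lt) =
      let k , o = Opt-exists M E 1≤M in
      strictly o (ℤ.<-≤-trans lt (Opt-maximal o l 1≤l l≤M))
    from-co-─ (clique k K o) = tightly o (value-clique K (- t′))
      (λ { refl → clique-Side (IsClique-co-all G v iso K) (s≤s z≤n) ℕ.≤-refl })
      (λ { refl _ → clique-Side (IsClique-co-singleton G v iso K) 1≤M (ℕ.n≤1+n M) })
    from-co-─ (tie k 1≤k k<M E≡ eq) = tightly (tie-Opt 1≤k (ℕ.<⇒≤ k<M) E≡) eq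
      (λ { refl → ⊥-elim (ℕ.<-irrefl refl k<M) })
      (λ _ E<0 → ⊥-elim (ℤ.<⇒≱ E<0 (subst (0ℤ ≤_) (sym E≡) (q-mono {1} {k} ℕ.≤-refl 1≤k))))

    step : Side (G ─ v) t′ ⊎ Side (complement (G ─ v)) (- t′) → Sides
    step (inj₁ s) = inj₁ (from-─ s)
    step (inj₂ s) = from-co-─ s

  dichotomy : ∀ n (G : Graph (suc n)) → Nested G → ∀ t → Side G t ⊎ Side (complement G) (- t)
  dichotomy zero G _ t =
    inj₁ (clique-Side (complete⇒IsClique G λ { zero zero i≢i → ⊥-elim (i≢i refl) }) ℕ.≤-refl ℕ.≤-refl)
  dichotomy (suc n) G nested t with isolated-or-dominating G nested
  ... | inj₁ (v , iso) = Step.step (s≤s z≤n) G v iso t (dichotomy n (G ─ v) (Nested-─ G v iso nested) _)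
  -- A dominating vertex is isolated in the complement, so the step is carried out there at -t, and
  -- its two sides come back exchanged.
  ... | inj₂ (v , iso)
    with Step.step (s≤s z≤n) (complement G) v iso (- t)
           (dichotomy n (complement G ─ v) (Nested-─ (complement G) v iso
               (Nested-complement G nested)) _)
  ...   | inj₁ s = inj₂ s
  ...   | inj₂ s = inj₁ (subst (Side G) (ℤ.neg-involutive t) (Side-cong (complement
      (complement G)) G (complement-complement G) s))

open Dichotomy

-- Edge shifts and nestedness of maximisers

module EdgeShifts where
  open import Data.Integer using (_+_; _*_; _-_; -_; _≤_; _<_)

  module Shift {n} (G : Graph n) (u v w : Fin n) (w≢v : w ≢ v)
    (uw : adj G u w ≡ true) (vw : adj G v w ≡ false) where

    u≢v : u ≢ v
    u≢v refl with () ← trans (sym uw) vw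

    w≢u : w ≢ u
    w≢u refl with () ← trans (sym uw) (irrefl G w)

    -- Toggling the pairs wu and wv with xor deletes the one edge and creates the other in a single
    -- formula.
    half toggled : Fin n → Fin n → Bool
    half i j = does (w ≟ i) ∧ (does (u ≟ j) ∨ does (v ≟ j))
    toggled i j = half i j ∨ half j i

    half-diag : ∀ i → half i i ≡ false
    half-diag i with w ≟ i
    ... | no _     = refl
    ... | yes refl = cong₂ _∨_ (dec-false (u ≟ w) (w≢u ∘ sym)) (dec-false (v ≟ w) (w≢v ∘ sym))

    shift : Graph n
    shift = record
      { adj    = λ i j → adj G i j xor toggled i j
      ; symm   = λ i j → cong₂ _xor_ (symm G i j) (Bool.∨-comm (half i j) (half j i))
      ; irrefl = λ i → cong₂ _xor_ (irrefl G i) (cong₂ _∨_ (half-diag i) (half-diag i))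
      }

    edge-shift : ∀ i j → edge shift i j ≡ edge G i j + (δ w i * (δ v j - δ u j) + δ w j *
        (δ v i - δ u i))
    edge-shift i j with w ≟ i | w ≟ j
    ... | yes refl | yes refl rewrite dec-false (u ≟ w) (w≢u ∘ sym) | dec-false (v ≟ w) (w≢v ∘ sym)
      | irrefl G w = refl
    ... | no _ | no _ = trans (cong ⟦_⟧ (Bool.xor-identityʳ (adj G i j))) (sym (ℤ.+-identityʳ
        (edge G i j)))
    ... | yes refl | no _ with u ≟ j | v ≟ j
    ...   | yes refl | yes refl = ⊥-elim (u≢v refl)
    ...   | yes refl | no _ rewrite symm G w u | uw = refl
    ...   | no _ | yes refl rewrite symm G w v | vw = refl
    ...   | no _ | no _ = trans (cong ⟦_⟧ (Bool.xor-identityʳ (adj G w j))) (sym (ℤ.+-identityʳ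
        (edge G w j)))
    edge-shift i j | no _ | yes refl with u ≟ i | v ≟ i
    ...   | yes refl | yes refl = ⊥-elim (u≢v refl)
    ...   | yes refl | no _ rewrite uw = refl
    ...   | no _ | yes refl rewrite vw = refl
    ...   | no _ | no _ = trans (cong ⟦_⟧ (Bool.xor-identityʳ (adj G i w))) (sym (ℤ.+-identityʳ
        (edge G i w)))

    deg-shift : ∀ i → deg shift i ≡ deg G i + (δ v i - δ u i)
    deg-shift i = begin
      (∑ λ j → edge shift i j)
        ≡⟨ ∑-cong (edge-shift i) ⟩
      (∑ λ j → edge G i j + (δ w i * (δ v j - δ u j) + δ w j * (δ v i - δ u i)))
        ≡⟨ trans (∑-+ (edge G i) _) (cong (λ z → deg G i + z) (trans (∑-+ (λ j → δ w i * (δ v j - δ u j)) _)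
             (cong₂ _+_ (trans (∑-*ˡ (δ w i) (λ j → δ v j - δ u j)) (cong (δ w i *_) (∑-- (δ v) (δ u))))
               (∑-*ʳ (δ v i - δ u i) (δ w))))) ⟩
      deg G i + (δ w i * (∑ (δ v) - ∑ (δ u)) + ∑ (δ w) * (δ v i - δ u i))
        ≡⟨ cong₂ (λ a b → deg G i + (δ w i * a + b * (δ v i - δ u i)))
             (cong₂ _-_ (∑-δ-1 v) (∑-δ-1 u)) (∑-δ-1 w) ⟩
      deg G i + (δ w i * (1ℤ - 1ℤ) + 1ℤ * (δ v i - δ u i))
        -- The degree of w does not change, since w loses u and gains v.
        ≡⟨ lemma (deg G i) (δ w i) (δ v i - δ u i) ⟩
      deg G i + (δ v i - δ u i) ∎
      where
      lemma : ∀ d a b → d + (a * (1ℤ - 1ℤ) + 1ℤ * b) ≡ d + b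
      lemma = solve-∀

    degSum-shift : degSum shift ≡ degSum G
    degSum-shift = trans (∑-cong deg-shift) (trans (∑-+ (deg G) _)
      (trans (cong (λ z → degSum G + z) (trans (∑-- (δ v) (δ u)) (cong₂ _-_ (∑-δ-1 v) (∑-δ-1 u))))
          (ℤ.+-identityʳ _)))

    degSum²-shift : degSum² shift ≡ degSum² G + (+ 2 * (deg G v - deg G u) + + 2)
    degSum²-shift = begin
      (∑ λ i → deg shift i * deg shift i)
        ≡⟨ ∑-cong (λ i → trans (cong (λ d → d * d) (deg-shift i)) (square i)) ⟩
      (∑ λ i → deg G i * deg G i + (+ 2 * (δ v i * deg G i - δ u i * deg G i) + (δ v i + δ u i)))
        ≡⟨ trans (∑-+ (λ i → deg G i * deg G i) _) (cong (λ z → degSum² G + z)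
            (trans (∑-+ (λ i → + 2 * (δ v i * deg G i - δ u i * deg G i)) (λ i → δ v i + δ u i))
              (cong₂ _+_ (trans (∑-*ˡ (+ 2) (λ i → δ v i * deg G i - δ u i * deg G i)) (cong (+ 2 *_)
                  (trans (∑-- (λ i → δ v i * deg G i) (λ i → δ u i * deg G i)) (cong₂ _-_ (∑-δ v
                      (deg G)) (∑-δ u (deg G))))))
                (trans (∑-+ (δ v) (δ u)) (cong₂ _+_ (∑-δ-1 v) (∑-δ-1 u)))))) ⟩
      degSum² G + (+ 2 * (deg G v - deg G u) + + 2) ∎
      where
      none : ∀ d → (d + 0ℤ) * (d + 0ℤ) ≡ d * d + (+ 2 * (0ℤ * d - 0ℤ * d) + 0ℤ)
      none = solve-∀
      plus : ∀ d → (d + 1ℤ) * (d + 1ℤ) ≡ d * d + (+ 2 * (1ℤ * d - 0ℤ * d) + 1ℤ)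
      plus = solve-∀
      minus : ∀ d → (d + - 1ℤ) * (d + - 1ℤ) ≡ d * d + (+ 2 * (0ℤ * d - 1ℤ * d) + 1ℤ)
      minus = solve-∀
      square : ∀ i → (deg G i + (δ v i - δ u i)) * (deg G i + (δ v i - δ u i))
        ≡ deg G i * deg G i + (+ 2 * (δ v i * deg G i - δ u i * deg G i) + (δ v i + δ u i))
      square i with v ≟ i | u ≟ i
      ... | yes refl | yes refl = ⊥-elim (u≢v refl)
      ... | yes _ | no _  = plus (deg G i)
      ... | no _  | yes _ = minus (deg G i)
      ... | no _  | no _  = none (deg G i)

    Λ-shift : deg G u ≤ deg G v → Λ H G ℕ.< Λ H shift
    -- Λ grows by 4 times 2(d(v) - d(u)) + 2; the 7 is the resulting 8 less the 1 of a strict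
    -- inequality.
    Λ-shift du≤dv = ℤ.drop‿+<+ (diff-< eq (0≤+ 8 ⊗ ≤-diff du≤dv ⊕ 0≤+ 7))
      where
      lemma : ∀ n X S d → X * (n * (n - 1ℤ) - X) - + 4 * (n - 1ℤ) * X + + 4 * (S + (+ 2 * d + + 2))
        - (X * (n * (n - 1ℤ) - X) - + 4 * (n - 1ℤ) * X + + 4 * S) - 1ℤ ≡ + 8 * d + + 7
      lemma = solve-∀
      eq : + Λ H shift - + Λ H G - 1ℤ ≡ + 8 * (deg G v - deg G u) + + 7
      eq = trans (cong₂ (λ a b → a - b - 1ℤ)
          (trans (Λ-deg shift) (cong₂ (λ X S → X * (+ n * (+ n - 1ℤ) - X) - + 4 *
              (+ n - 1ℤ) * X + + 4 * S) degSum-shift degSum²-shift))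
          (Λ-deg G))
        (lemma (+ n) (degSum G) (degSum² G) (deg G v - deg G u))

  Maximal : ∀ {n} → Graph n → Set
  Maximal {n} G = (G′ : Graph n) → Λ H G′ ℕ.≤ Λ H G

  Maximal⇒Nested : ∀ {n} (G : Graph n) → Maximal G → Nested G
  Maximal⇒Nested G max u v w du≤dv w≢v uw = go (adj G v w) refl
    where
    go : ∀ b → adj G v w ≡ b → b ≡ true
    go true  _  = refl
    go false vw = ⊥-elim (ℕ.<⇒≱ (Λ-shift du≤dv) (max shift))
      where open Shift G u v w w≢v uw vw

open EdgeShifts

-- Isomorphism invariance and uniqueness of cliques

module Isomorphisms where
  open import Data.Integer using (_+_; _*_; _-_; -_; _≤_; _<_)
  open IsClique

  ⟨$⟩ʳ-injective : ∀ {n} (π : Permutation′ n) {i j} → π ⟨$⟩ʳ i ≡ π ⟨$⟩ʳ j → i ≡ j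
  ⟨$⟩ʳ-injective π = Injection.injective (↔⇒↣ π)

  does-⟨$⟩ʳ : ∀ {n} (π : Permutation′ n) i j → does (π ⟨$⟩ʳ i ≟ π ⟨$⟩ʳ j) ≡ does (i ≟ j)
  does-⟨$⟩ʳ π i j with i ≟ j
  ... | yes e  = dec-true (π ⟨$⟩ʳ i ≟ π ⟨$⟩ʳ j) (cong (π ⟨$⟩ʳ_) e)
  ... | no i≢j = dec-false (π ⟨$⟩ʳ i ≟ π ⟨$⟩ʳ j) (i≢j ∘ ⟨$⟩ʳ-injective π)

  ≅-complement : ∀ {n} {G G′ : Graph n} → G ≅ G′ → complement G ≅ complement G′
  ≅-complement (π , e) = π , λ i j → cong₂ (λ a b → not a ∧ not b) (sym (does-⟨$⟩ʳ π i j)) (e i j)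

  module _ {n} (G G′ : Graph n) (iso : G ≅ G′) where
    private
      π = proj₁ iso

    deg-≅ : ∀ i → deg G i ≡ deg G′ (π ⟨$⟩ʳ i)
    deg-≅ i = trans (∑-cong λ j → cong ⟦_⟧ (proj₂ iso i j)) (sym (∑-permute (edge G′ (π ⟨$⟩ʳ i)) π))

    degSum-≅ : degSum G ≡ degSum G′
    degSum-≅ = trans (∑-cong deg-≅) (sym (∑-permute (deg G′) π))

    degSum²-≅ : degSum² G ≡ degSum² G′
    degSum²-≅ = trans (∑-cong λ i → cong (λ d → d * d) (deg-≅ i)) (sym (∑-permute (λ i
        → deg G′ i * deg G′ i) π))

    Λ-≅ : Λ H G ≡ Λ H G′
    Λ-≅ = ℤ.+-injective (trans (Λ-deg G) (trans
      (cong₂ (λ X S → X * (+ n * (+ n - 1ℤ) - X) - + 4 * (+ n - 1ℤ) * X + + 4 * S) degSum-≅ degSum²-≅)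
      (sym (Λ-deg G′))))

  initial : ∀ {n} → ℕ → Fin n → Bool
  initial l i = does (toℕ i ℕ.<? l)

  ∑-initial : ∀ {n} l → l ℕ.≤ n → ∑ {n} (λ i → ⟦ initial l i ⟧) ≡ + l
  ∑-initial {n} zero l≤n = trans (∑-const n 0ℤ) (ℤ.*-zeroʳ (+ n))
  ∑-initial {suc n} (suc l) (s≤s l≤n) = trans (∑-suc {n} _) (cong (λ z → 1ℤ + z) (∑-initial l l≤n))

  toℕ-punchIn-fromℕ : ∀ {n} (j : Fin n) → toℕ (punchIn (fromℕ n) j) ≡ toℕ j
  toℕ-punchIn-fromℕ {suc n} zero    = refl
  toℕ-punchIn-fromℕ {suc n} (suc j) = cong suc (toℕ-punchIn-fromℕ j)

  -- Members are moved to the front: if 0 is a member it stays first, and otherwise it is sent to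
  -- the last place.
  sort : ∀ {n} (S : Fin n → Bool) → ∃[ l ] (l ℕ.≤ n × ∑ (λ i → ⟦ S i ⟧) ≡ + l
    × Σ[ π ∈ Permutation′ n ] (∀ i → S i ≡ initial l (π ⟨$⟩ʳ i)))
  sort {zero}  S = 0 , z≤n , ∑-zero _ , Perm.id , λ ()
  sort {suc n} S with sort (S ∘ suc) | S zero in S₀
  ... | l , l≤n , size , π , e | true = suc l , s≤s l≤n
    , trans (∑-suc _) (cong₂ _+_ (cong ⟦_⟧ S₀) size)
    , lift₀ π , λ { zero → S₀ ; (suc i) → e i }
  ... | l , l≤n , size , π , e | false = l , ℕ.m≤n⇒m≤1+n l≤n
    , trans (∑-suc _) (trans (cong₂ _+_ (cong ⟦_⟧ S₀) size) (ℤ.+-identityˡ (+ l)))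
    , insert zero (fromℕ n) π
    , λ { zero → trans S₀ (sym (dec-false (toℕ (fromℕ n) ℕ.<? l)
                   (λ lt → ℕ.<⇒≱ lt (subst (l ℕ.≤_) (sym (Fin.toℕ-fromℕ n)) l≤n))))
        ; (suc i) → trans (e i) (cong (λ k → does (k ℕ.<? l)) (sym (trans
                      (cong toℕ (insert-punchIn zero (fromℕ n) π i)) (toℕ-punchIn-fromℕ (π ⟨$⟩ʳ i))))) }

  -- A standard model through which cliques of equal order are isomorphic; it is also the competitor
  -- that rules out `below` for a maximiser.
  initialClique : ∀ n → ℕ → Graph n
  initialClique n l = record
    { adj    = λ i j → initial l i ∧ initial l j ∧ not (does (i ≟ j))
    ; symm   = λ i j → trans (sym (Bool.∧-assoc (initial l i) (initial l j) _))
        (trans (cong₂ _∧_ (Bool.∧-comm (initial l i) (initial l j)) (cong not (≟-sym i j)))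
          (Bool.∧-assoc (initial l j) (initial l i) _))
    ; irrefl = λ i → trans (cong (λ b → initial l i ∧ initial l i ∧ not b) (dec-true (i ≟ i) refl))
        (trans (cong (initial l i ∧_) (Bool.∧-zeroʳ (initial l i))) (Bool.∧-zeroʳ (initial l i)))
    }
    where
    ≟-sym : ∀ (i j : Fin n) → does (i ≟ j) ≡ does (j ≟ i)
    ≟-sym i j with i ≟ j
    ... | yes e = sym (dec-true (j ≟ i) (sym e))
    ... | no ¬e = sym (dec-false (j ≟ i) (¬e ∘ sym))

  initialClique-IsClique : ∀ {n l} → l ℕ.≤ n → IsClique (initialClique n l) l
  initialClique-IsClique {l = l} l≤n = record
    { member = initial l ; size = ∑-initial l l≤n ; adjacent = λ _ _ → refl }

  IsClique⇒≅ : ∀ {n} {G : Graph n} {l} → IsClique G l → G ≅ initialClique n l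
  IsClique⇒≅ {G = G} {l} K with sort (member K)
  ... | l′ , l′≤n , size′ , π , e with ℤ.+-injective (trans (sym (size K)) size′)
  ...   | refl = π , λ i j → trans (adjacent K i j)
    (cong₂ _∧_ (e i) (cong₂ _∧_ (e j) (cong not (sym (does-⟨$⟩ʳ π i j)))))

  ≅-sym : ∀ {n} {G G′ : Graph n} → G ≅ G′ → G′ ≅ G
  ≅-sym {G = G} {G′} (π , e) = Perm.flip π , λ i j →
    trans (sym (cong₂ (adj G′) (Perm.inverseʳ π) (Perm.inverseʳ π))) (sym (e _ _))

  ≅-trans : ∀ {n} {G G′ G″ : Graph n} → G ≅ G′ → G′ ≅ G″ → G ≅ G″
  ≅-trans (π , e) (ρ , f) = π Perm.∘ₚ ρ , λ i j → trans (e i j) (f _ _)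

  IsClique-≅ : ∀ {n l} {G G′ : Graph n} → IsClique G l → IsClique G′ l → G ≅ G′
  IsClique-≅ {n} {l} {G} {G′} K K′ =
    ≅-trans {G = G} {initialClique n l} {G′} (IsClique⇒≅ K) (≅-sym {G = G′} {initialClique n l}
        (IsClique⇒≅ K′))

open Isomorphisms

-- Quasi-cliques and the arithmetic of the floor

module QuasiCliques where
  open import Data.Integer using (_+_; _*_; _-_; -_; _≤_; _<_)

  C2-mono : ∀ {i j} → i ℕ.≤ j → i C 2 ℕ.≤ j C 2
  C2-mono z≤n = z≤n
  C2-mono {suc i} {suc j} (s≤s i≤j) =
    subst₂ ℕ._≤_ (sym ([1+k]C2≡k+kC2 i)) (sym ([1+k]C2≡k+kC2 j)) (ℕ.+-mono-≤ i≤j (C2-mono i≤j))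

  C2-< : ∀ {k} → 1 ℕ.≤ k → k C 2 ℕ.< suc k C 2
  C2-< {k} 1≤k = subst (k C 2 ℕ.<_) (sym ([1+k]C2≡k+kC2 k)) (ℕ.+-monoˡ-≤ (k C 2) 1≤k)

  cliqueParameter-C2 : ∀ k → 1 ℕ.≤ k → cliqueParameter (suc k C 2) ≡ k
  cliqueParameter-C2 k 1≤k = ℕ.≤-antisym
    (ℕ.≮⇒≥ λ k<p → ℕ.<⇒≱ (proj₁ isGreatest) (C2-mono k<p))
    (proj₂ isGreatest k (C2-< 1≤k))
    where
    isGreatest : IsGreatest (λ j → j C 2 ℕ.< suc k C 2) (cliqueParameter (suc k C 2))
    isGreatest = cliqueParameter-isGreatest (suc k C 2) (ℕ.≤-trans (s≤s z≤n) (C2-< 1≤k))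

  -- With this number of edges the star to be removed is empty, so the quasi-clique is a full clique
  -- with isolated vertices.
  QC-adj : ∀ {n} k → 1 ℕ.≤ k → (i j : Fin n) →
    adj (QC n (suc k C 2)) i j ≡ initial (suc k) i ∧ initial (suc k) j ∧ not (does (i ≟ j))
  QC-adj {n} k 1≤k i j rewrite cliqueParameter-C2 k 1≤k | ℕ.n∸n≡0 (suc k C 2) = go
    where
    kept upper : Fin n → Fin n → Bool
    kept i j  = does (toℕ j ℕ.≤? k) ∧ not (does (toℕ j ℕ.≟ k) ∧ does (toℕ i ℕ.<? 0))
    upper i j = does (i Fin.<? j) ∧ kept i j
    ≤⇒initial : ∀ (j : Fin n) → does (toℕ j ℕ.≤? k) ≡ initial (suc k) j
    ≤⇒initial j = go (toℕ j)
      where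
      go : ∀ j → does (j ℕ.≤? k) ≡ does (j ℕ.<? suc k)
      go zero    = refl
      go (suc j) = refl
    initial-∧ : ∀ {i j : Fin n} → i Fin.< j → initial (suc k) j ≡ initial (suc k) i ∧ initial (suc k) j
    initial-∧ {i} {j} i<j = go (toℕ j ℕ.<? suc k)
      where
      go : Dec (toℕ j ℕ.< suc k) → initial (suc k) j ≡ initial (suc k) i ∧ initial (suc k) j
      go (yes p) = trans (dec-true (toℕ j ℕ.<? suc k) p) (sym (cong₂ _∧_
        (dec-true (toℕ i ℕ.<? suc k) (ℕ.<-trans i<j p)) (dec-true (toℕ j ℕ.<? suc k) p)))
      go (no ¬p) = trans (dec-false (toℕ j ℕ.<? suc k) ¬p) (sym (trans
        (cong (initial (suc k) i ∧_) (dec-false (toℕ j ℕ.<? suc k) ¬p)) (Bool.∧-zeroʳ (initial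
            (suc k) i))))
    upper-< : ∀ {i j} → i Fin.< j → upper i j ≡ initial (suc k) i ∧ initial (suc k) j
    upper-< {i} {j} i<j = trans (cong (_∧ kept i j) (dec-true (i Fin.<? j) i<j)) (trans
      (cong (does (toℕ j ℕ.≤? k) ∧_) (cong not (trans (cong (does (toℕ j ℕ.≟ k) ∧_) (dec-false
          (toℕ i ℕ.<? 0) λ ())) (Bool.∧-zeroʳ _))))
      (trans (Bool.∧-identityʳ _) (trans (≤⇒initial j) (initial-∧ i<j))))
    upper-≮ : ∀ {i j} → ¬ i Fin.< j → upper i j ≡ false
    upper-≮ {i} {j} i≮j = cong (_∧ kept i j) (dec-false (i Fin.<? j) i≮j)
    distinct : ∀ b c → i ≢ j → b ∧ c ≡ b ∧ c ∧ not (does (i ≟ j))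
    distinct b c i≢j = cong (b ∧_) (sym (trans (cong (λ d → c ∧ not d) (dec-false (i ≟ j) i≢j))
        (Bool.∧-identityʳ c)))
    go : upper i j ∨ upper j i ≡ initial (suc k) i ∧ initial (suc k) j ∧ not (does (i ≟ j))
    go with Fin.<-cmp i j
    ... | tri< i<j i≢j j≮i = trans (cong₂ _∨_ (upper-< i<j) (upper-≮ j≮i))
      (trans (Bool.∨-identityʳ _) (distinct (initial (suc k) i) (initial (suc k) j) i≢j))
    ... | tri> i≮j i≢j j<i = trans (cong₂ _∨_ (upper-≮ i≮j) (upper-< j<i))
      (trans (Bool.∧-comm (initial (suc k) j) (initial (suc k) i)) (distinct (initial (suc k) i)
          (initial (suc k) j) i≢j))
    ... | tri≈ i≮i refl _ = trans (cong₂ _∨_ (upper-≮ i≮i) (upper-≮ i≮i)) (sym (irrefl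
        (initialClique n (suc k)) i))

  QC-IsClique : ∀ {n k} → 1 ℕ.≤ k → k ℕ.< n → IsClique (QC n ((k ℕ.+ 1) C 2)) (suc k)
  QC-IsClique {n} {k} 1≤k k<n rewrite ℕ.+-comm k 1 = record
    { member = initial (suc k) ; size = ∑-initial (suc k) k<n ; adjacent = QC-adj k 1≤k }

  *-square-mono : ∀ {a b} → 0ℤ ≤ a → a ≤ b → a * a ≤ b * b
  *-square-mono {a} {b} 0≤a a≤b = diff-≤ (lemma a b) (≤-diff a≤b ⊗ (0≤a ⊕ ℤ.≤-trans 0≤a a≤b))
    where
    lemma : ∀ a b → b * b - a * a ≡ (b - a) * (a + b)
    lemma = solve-∀

  square-cancel-< : ∀ {a b} → 0ℤ ≤ b → a * a < b * b → a < b
  square-cancel-< 0≤b a²<b² = ℤ.≰⇒> λ b≤a → ℤ.<⇒≱ a²<b² (*-square-mono 0≤b b≤a)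

  2*i≢1 : ∀ i → + 2 * i ≢ 1ℤ
  2*i≢1 (+ zero) ()
  2*i≢1 (+ suc i) e = ℤ.<-irrefl (sym e) (diff-< (lemma (+ i)) (0≤+ 2 ⊗ 0≤+ i))
    where
    lemma : ∀ i → + 2 * (1ℤ + i) - 1ℤ - 1ℤ ≡ + 2 * i
    lemma = solve-∀
  2*i≢1 -[1+ i ] ()

  i*i≡∣i∣*∣i∣ : ∀ i → i * i ≡ + ∣ i ∣ * + ∣ i ∣
  i*i≡∣i∣*∣i∣ (+ n)    = refl
  i*i≡∣i∣*∣i∣ -[1+ n ] = refl

  -- Together with `[2k-3]²` this turns (2k-3)² ≤ radicand n into q k ≤ D. So ⌊x₀⌋ is the last
  -- clique order at which one more vertex does not lower Λ, and the best order is ⌊x₀⌋ + 1.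
  radicand≡ : ∀ n → radicand n ≡ + 2 * D n 0ℤ + 1ℤ
  radicand≡ n = lemma (+ n)
    where
    lemma : ∀ n → + 2 * (n * n) - + 10 * n + + 13 ≡ + 2 * ((n - + 2) * (n - + 3) + 0ℤ) + 1ℤ
    lemma = solve-∀

  [2k-3]² : ∀ k → (+ 2 * k - + 3) * (+ 2 * k - + 3) ≡ + 2 * q k + 1ℤ
  [2k-3]² = lemma
    where
    lemma : ∀ k → (+ 2 * k - + 3) * (+ 2 * k - + 3) ≡ + 2 * (+ 2 * ((k - 1ℤ) * (k - + 2))) + 1ℤ
    lemma = solve-∀

  tie⇒IsSquare : ∀ n k → D n 0ℤ ≡ q (+ k) → IsSquare (radicand n)
  tie⇒IsSquare n k D≡q = + 2 * + k - + 3 , trans (radicand≡ n) (trans (cong (λ d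
      → + 2 * d + 1ℤ) D≡q) (sym ([2k-3]² (+ k))))

  module Floor (n k : ℕ) (4≤n : 4 ℕ.≤ n) (floor : IsGreatest (_≤x₀[ n ]) k) where

    private
      m = n ℕ.∸ 4
      n≡ : + n ≡ + 4 + + m
      n≡ = cong +_ (sym (ℕ.m+[n∸m]≡n 4≤n))

    D>0 : 1ℤ ≤ D n 0ℤ
    D>0 = subst (λ N → 1ℤ ≤ (N - + 2) * (N - + 3) + 0ℤ) (sym n≡)
      (diff-≤ (lemma (+ m)) (0≤i² (+ m) ⊕ 0≤+ 3 ⊗ 0≤+ m ⊕ 0≤+ 1))
      where
      lemma : ∀ m → (+ 4 + m - + 2) * (+ 4 + m - + 3) + 0ℤ - 1ℤ ≡ m * m + + 3 * m + + 1
      lemma = solve-∀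

    -- At 2 the floor condition reads 1 ≤ radicand n. The bound makes 2k - 3 positive, which
    -- excludes the first clause of `≤√`.
    2≤k : 2 ℕ.≤ k
    2≤k = proj₂ floor 2 (inj₂ (subst (1ℤ ≤_) (sym (radicand≡ n))
      (diff-≤ (lemma (D n 0ℤ)) (0≤+ 2 ⊗ ℤ.≤-trans (0≤+ 1) D>0))))
      where
      lemma : ∀ d → + 2 * d + 1ℤ - 1ℤ ≡ + 2 * d
      lemma = solve-∀

    1≤k : 1 ℕ.≤ k
    1≤k = ℕ.≤-trans (s≤s z≤n) 2≤k

    0<2k-3 : 0ℤ < + 2 * + k - + 3
    0<2k-3 = diff-< (lemma (+ k)) (0≤+ 2 ⊗ ≤-diff {+ 2} {+ k} (+≤+ 2≤k))
      where
      lemma : ∀ k → + 2 * k - + 3 - 0ℤ - 1ℤ ≡ + 2 * (k - + 2)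
      lemma = solve-∀

    private
      halve : ∀ {a b} → + 2 * a + 1ℤ ≤ + 2 * b + 1ℤ → a ≤ b
      halve {a} {b} p = ℤ.*-cancelˡ-≤-pos a b (+ 2) (diff-≤ (lemma (+ 2 * a) (+ 2 * b)) (≤-diff p))
        where
        lemma : ∀ a b → b - a ≡ b + 1ℤ - (a + 1ℤ)
        lemma = solve-∀

    [2k-3]²≤ : (+ 2 * + k - + 3) * (+ 2 * + k - + 3) ≤ radicand n
    [2k-3]²≤ = Sum.[ (λ ≤0 → ⊥-elim (ℤ.<⇒≱ 0<2k-3 ≤0)) , (λ p → p) ]′ (proj₁ floor)

    <[2k-1]² : radicand n < (+ 2 * + suc k - + 3) * (+ 2 * + suc k - + 3)
    <[2k-1]² = ℤ.≰⇒> λ p → ℕ.<-irrefl refl (proj₂ floor (suc k) (inj₂ p))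

    q≤D : q (+ k) ≤ D n 0ℤ
    q≤D = halve (subst₂ _≤_ ([2k-3]² (+ k)) (radicand≡ n) [2k-3]²≤)

    D≤q : D n 0ℤ ≤ q (+ suc k)
    D≤q = halve (subst₂ _≤_ (radicand≡ n) ([2k-3]² (+ suc k)) (ℤ.<⇒≤ <[2k-1]²))

    -- If n ≤ k + 1, then q (n - 1) ≤ q k ≤ D, but q (n - 1) = 2D and D > 0. Of the two vertices
    -- left beside a clique of order k, one is later joined to it and the other stays isolated.
    k+2≤n : suc (suc k) ℕ.≤ n
    k+2≤n = ℕ.≰⇒> λ n≤k+1 → contra n n≤k+1 4≤n q≤D D>0
      where
      contra : ∀ n → n ℕ.≤ suc k → 4 ℕ.≤ n → q (+ k) ≤ D n 0ℤ → 1ℤ ≤ D n 0ℤ → ⊥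
      contra (suc n) (s≤s n≤k) (s≤s 3≤n) q≤D D>0 = ℤ.<⇒≱ {D (suc n) 0ℤ} {q (+ n)}
        (diff-< (lemma (+ n)) (≤-diff D>0))
        (ℤ.≤-trans (q-mono (ℕ.≤-trans (s≤s z≤n) 3≤n) n≤k) q≤D)
        where
        lemma : ∀ n → + 2 * ((n - 1ℤ) * (n - + 2)) - ((1ℤ + n - + 2) * (1ℤ + n - + 3) + 0ℤ) - 1ℤ
          ≡ (1ℤ + n - + 2) * (1ℤ + n - + 3) + 0ℤ - 1ℤ
        lemma = solve-∀

    k<n : k ℕ.< n
    k<n = ℕ.<⇒≤ k+2≤n

    Opt-k+1 : Opt n (D n 0ℤ) (suc k)
    Opt-k+1 = opt (s≤s z≤n) k<n (inj₂ (k , refl , q≤D)) (inj₂ D≤q)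

    -- The root has the parity of radicand n, so it is 2k - 3 and not 2k - 2.
    IsSquare⇒tie : IsSquare (radicand n) → D n 0ℤ ≡ q (+ k)
    IsSquare⇒tie (z , rad≡z²) = ℤ.≤-antisym (halve (subst₂ _≤_ (radicand≡ n) ([2k-3]² (+ k)) rad≤)) q≤D
      where
      s y : ℤ
      s = + 2 * + k - + 3
      y = + ∣ z ∣
      rad≡y² : radicand n ≡ y * y
      rad≡y² = trans rad≡z² (i*i≡∣i∣*∣i∣ z)
      y<s+2 : y < + 2 * + suc k - + 3
      y<s+2 = square-cancel-< (ℤ.≤-trans (ℤ.<⇒≤ 0<2k-3) (diff-≤ (lemma (+ k)) (0≤+ 2))) (subst
          (_< _) rad≡y² <[2k-1]²)
        where
        lemma : ∀ k → + 2 * (1ℤ + k) - + 3 - (+ 2 * k - + 3) ≡ + 2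
        lemma = solve-∀
      even : y ≢ s + 1ℤ
      even e = 2*i≢1 (+ 2 * ((+ k - 1ℤ) * (+ k - 1ℤ)) - D n 0ℤ) (trans (lemma (+ k) (D n 0ℤ))
        (trans (cong (λ r → r - + 2 * D n 0ℤ) (trans (cong (λ w → w * w) (sym e)) (trans
            (sym rad≡y²) (radicand≡ n))))
          (lemma₂ (+ 2 * D n 0ℤ))))
        where
        lemma : ∀ k d → + 2 * (+ 2 * ((k - 1ℤ) * (k - 1ℤ)) - d) ≡ (+ 2 * k - + 3 + 1ℤ) *
            (+ 2 * k - + 3 + 1ℤ) - + 2 * d
        lemma = solve-∀
        lemma₂ : ∀ d → d + 1ℤ - d ≡ 1ℤ
        lemma₂ = solve-∀
      y≤s : y ≤ s
      y≤s = ℤ.≮⇒≥ λ s<y → even (ℤ.≤-antisym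
        (diff-≤ (lemma y (+ k)) (<-diff y<s+2))
        (diff-≤ (lemma₂ y s) (<-diff s<y)))
        where
        lemma : ∀ y k → + 2 * k - + 3 + 1ℤ - y ≡ + 2 * (1ℤ + k) - + 3 - y - 1ℤ
        lemma = solve-∀
        lemma₂ : ∀ y s → y - (s + 1ℤ) ≡ y - s - 1ℤ
        lemma₂ = solve-∀
      rad≤ : radicand n ≤ s * s
      rad≤ = subst (_≤ s * s) (sym rad≡y²) (*-square-mono (0≤+ ∣ z ∣) y≤s)

open QuasiCliques

-- Maximisers, uniqueness and the families at a tie

module Extremal where
  open import Data.Integer using (_+_; _*_; _-_; -_; _≤_; _<_)

  -- A clique on S together with a vertex v outside it whose neighbours are T.
  module Pendant {n} (S T : Fin n → Bool) (v : Fin n) (Sv : S v ≡ false)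
    (T⊆S : ∀ i → T i ≡ true → S i ≡ true) {k j : ℕ}
    (sizeS : ∑ (λ i → ⟦ S i ⟧) ≡ + k) (sizeT : ∑ (λ i → ⟦ T i ⟧) ≡ + j) where

    Tv : T v ≡ false
    Tv with T v in eq
    ... | false = refl
    ... | true with () ← trans (sym (T⊆S v eq)) Sv

    private
      core link : Fin n → Fin n → Bool
      core a b = S a ∧ S b ∧ not (does (a ≟ b))
      link a b = does (v ≟ a) ∧ T b

      core-symm : ∀ a b → core a b ≡ core b a
      core-symm a b with a ≟ b
      ... | yes refl rewrite dec-true (a ≟ a) refl = refl
      ... | no a≢b rewrite dec-false (b ≟ a) (a≢b ∘ sym) | Bool.∧-identityʳ
          (S b) | Bool.∧-identityʳ (S a) =
        Bool.∧-comm (S a) (S b)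

      link-diag : ∀ a → link a a ≡ false
      link-diag a with v ≟ a
      ... | yes refl = Tv
      ... | no _     = refl

      core-diag : ∀ a → core a a ≡ false
      core-diag a rewrite dec-true (a ≟ a) refl | Bool.∧-zeroʳ (S a) = Bool.∧-zeroʳ (S a)

    graph : Graph n
    graph = record
      { adj    = λ a b → core a b ∨ (link a b ∨ link b a)
      ; symm   = λ a b → cong₂ _∨_ (core-symm a b) (Bool.∨-comm (link a b) (link b a))
      ; irrefl = λ a → cong₂ _∨_ (core-diag a) (cong₂ _∨_ (link-diag a) (link-diag a))
      }

    isolated : ∀ a → S a ≡ false → a ≢ v → Isolated graph a
    isolated a Sa a≢v b rewrite Sa | dec-false (v ≟ a) (a≢v ∘ sym) = trans (cong (does
        (v ≟ b) ∧_) Ta) (Bool.∧-zeroʳ _)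
      where
      Ta : T a ≡ false
      Ta with T a in eq
      ... | false = refl
      ... | true with () ← trans (sym (T⊆S a eq)) Sa

    edge-graph : ∀ a b → edge graph a b
      ≡ ⟦ S a ⟧ * (⟦ S b ⟧ - δ a b * ⟦ S b ⟧) + (δ v a * ⟦ T b ⟧ + δ v b * ⟦ T a ⟧)
    edge-graph a b with v ≟ a | v ≟ b
    ... | yes refl | yes refl rewrite Sv | Tv = refl
    ... | yes refl | no _ rewrite Sv = trans (cong ⟦_⟧ (Bool.∨-identityʳ (T b))) (unit ⟦ T b ⟧)
      where
      unit : ∀ t → t ≡ 0ℤ + (1ℤ * t + 0ℤ)
      unit = solve-∀
    ... | no _ | yes refl rewrite Sv | Bool.∧-zeroʳ (S a) = drop ⟦ S a ⟧ (δ a v) ⟦ T a ⟧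
      where
      drop : ∀ s d t → t ≡ s * (0ℤ - d * 0ℤ) + (0ℤ + 1ℤ * t)
      drop = solve-∀
    ... | no _ | no _ with does (a ≟ b) | S a | S b
    ...   | true  | true  | true  = refl
    ...   | true  | true  | false = refl
    ...   | true  | false | _     = refl
    ...   | false | true  | true  = refl
    ...   | false | true  | false = refl
    ...   | false | false | _     = refl

    deg-graph : ∀ a → deg graph a ≡ ⟦ S a ⟧ * (+ k - ⟦ S a ⟧) + (δ v a * + j + ⟦ T a ⟧)
    deg-graph a = trans (∑-cong (edge-graph a)) (trans (∑-+ (λ b → ⟦ S a ⟧ *
        (⟦ S b ⟧ - δ a b * ⟦ S b ⟧)) _) (cong₂ _+_
      (trans (∑-*ˡ ⟦ S a ⟧ (λ b → ⟦ S b ⟧ - δ a b * ⟦ S b ⟧)) (cong (⟦ S a ⟧ *_)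
        (trans (∑-- (λ b → ⟦ S b ⟧) (λ b → δ a b * ⟦ S b ⟧)) (cong₂ _-_ sizeS (∑-δ a (λ b
            → ⟦ S b ⟧))))))
      (trans (∑-+ (λ b → δ v a * ⟦ T b ⟧) (λ b → δ v b * ⟦ T a ⟧)) (cong₂ _+_
        (trans (∑-*ˡ (δ v a) (λ b → ⟦ T b ⟧)) (cong (δ v a *_) sizeT))
        (∑-δ v (λ _ → ⟦ T a ⟧))))))

    deg-graph′ : ∀ a → deg graph a ≡ ⟦ S a ⟧ * (+ k - 1ℤ) + (δ v a * + j + ⟦ T a ⟧)
    deg-graph′ a = trans (deg-graph a) (cong (_+ (δ v a * + j + ⟦ T a ⟧)) (absorb (S a)))
      where
      absorb : ∀ b → ⟦ b ⟧ * (+ k - ⟦ b ⟧) ≡ ⟦ b ⟧ * (+ k - 1ℤ)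
      absorb true  = refl
      absorb false = refl

    private
      linear : ∀ α β γ → ∑ (λ a → ⟦ S a ⟧ * α + (δ v a * β + ⟦ T a ⟧ * γ)) ≡ + k * α + (β + + j * γ)
      linear α β γ = trans (∑-+ (λ a → ⟦ S a ⟧ * α) _) (cong₂ _+_
        (trans (∑-*ʳ α (λ a → ⟦ S a ⟧)) (cong (_* α) sizeS))
        (trans (∑-+ (λ a → δ v a * β) (λ a → ⟦ T a ⟧ * γ)) (cong₂ _+_
          (∑-δ v (λ _ → β)) (trans (∑-*ʳ γ (λ a → ⟦ T a ⟧)) (cong (_* γ) sizeT)))))

    degSum-graph : degSum graph ≡ + k * (+ k - 1ℤ) + (+ j + + j * 1ℤ)
    degSum-graph = trans (∑-cong λ a → trans (deg-graph′ a)
        (cong (λ z → ⟦ S a ⟧ * (+ k - 1ℤ) + (δ v a * + j + z)) (sym (ℤ.*-identityʳ ⟦ T a ⟧))))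
      (linear (+ k - 1ℤ) (+ j) 1ℤ)

    degSum²-graph : degSum² graph ≡ + k * ((+ k - 1ℤ) * (+ k - 1ℤ)) + (+ j * + j + + j *
        (+ 2 * + k - 1ℤ))
    degSum²-graph = trans (∑-cong λ a → trans (cong (λ d → d * d) (deg-graph′ a)) (square a))
      (linear ((+ k - 1ℤ) * (+ k - 1ℤ)) (+ j * + j) (+ 2 * + k - 1ℤ))
      where
      at-v : ∀ k j → (0ℤ * (k - 1ℤ) + (1ℤ * j + 0ℤ)) * (0ℤ * (k - 1ℤ) + (1ℤ * j + 0ℤ))
        ≡ 0ℤ * ((k - 1ℤ) * (k - 1ℤ)) + (1ℤ * (j * j) + 0ℤ * (+ 2 * k - 1ℤ))
      at-v = solve-∀
      in-T : ∀ k j → (1ℤ * (k - 1ℤ) + (0ℤ * j + 1ℤ)) * (1ℤ * (k - 1ℤ) + (0ℤ * j + 1ℤ))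
        ≡ 1ℤ * ((k - 1ℤ) * (k - 1ℤ)) + (0ℤ * (j * j) + 1ℤ * (+ 2 * k - 1ℤ))
      in-T = solve-∀
      in-S : ∀ k j → (1ℤ * (k - 1ℤ) + (0ℤ * j + 0ℤ)) * (1ℤ * (k - 1ℤ) + (0ℤ * j + 0ℤ))
        ≡ 1ℤ * ((k - 1ℤ) * (k - 1ℤ)) + (0ℤ * (j * j) + 0ℤ * (+ 2 * k - 1ℤ))
      in-S = solve-∀
      square : ∀ a → (⟦ S a ⟧ * (+ k - 1ℤ) + (δ v a * + j + ⟦ T a ⟧)) * (⟦ S a ⟧ * (+ k - 1ℤ) +
          (δ v a * + j + ⟦ T a ⟧))
        ≡ ⟦ S a ⟧ * ((+ k - 1ℤ) * (+ k - 1ℤ)) + (δ v a * (+ j * + j) + ⟦ T a ⟧ * (+ 2 * + k - 1ℤ))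
      square a with v ≟ a
      ... | yes refl rewrite Sv | Tv = at-v (+ k) (+ j)
      ... | no _ with T a in Ta | S a in Sa
      ...   | true  | true  = in-T (+ k) (+ j)
      ...   | true  | false with () ← trans (sym (T⊆S a Ta)) Sa
      square a | no _ | false | true  = in-S (+ k) (+ j)
      square a | no _ | false | false = refl

    -- The contribution 4j² of the degree of v cancels against (2j)² from the squared degree sum.
    -- What remains is affine in j, with a slope that vanishes exactly at a tie.
    Λ-graph : + Λ H graph ≡ A (+ k) (D n 0ℤ) + + 2 * (+ j * (D n 0ℤ - q (+ k)))
    Λ-graph = trans (Λ-deg graph) (trans
      (cong₂ (λ X S → X * (+ n * (+ n - 1ℤ) - X) - + 4 *
          (+ n - 1ℤ) * X + + 4 * S) degSum-graph degSum²-graph)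
      (lemma (+ n) (+ k) (+ j)))
      where
      lemma : ∀ n k j → (k * (k - 1ℤ) + (j + j * 1ℤ)) * (n * (n - 1ℤ) - (k * (k - 1ℤ) + (j + j * 1ℤ)))
          - + 4 * (n - 1ℤ) * (k * (k - 1ℤ) + (j + j * 1ℤ))
          + + 4 * (k * ((k - 1ℤ) * (k - 1ℤ)) + (j * j + j * (+ 2 * k - 1ℤ)))
        ≡ k * (k - 1ℤ) * ((n - + 2) * (n - + 3) + 0ℤ - (k - + 2) * (k - + 3))
          + + 2 * (j * ((n - + 2) * (n - + 3) + 0ℤ - + 2 * ((k - 1ℤ) * (k - + 2))))
      lemma = solve-∀

  -- A vertex isolated in G′ is dominating in its complement, which excludes an isolated vertex there.
  isolated⇒≇complement : ∀ {n} (G G′ : Graph (suc (suc n))) {v v′} →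
    Isolated G v → Isolated G′ v′ → ¬ G ≅ complement G′
  isolated⇒≇complement {n} G G′ {v} {v′} iso iso′ (π , e) with other a v
    where
    a = π ⟨$⟩ˡ v′
    other : ∀ a v → ∃[ b ] (a ≢ b × (a ≡ v ⊎ b ≡ v))
    other a v with a ≟ v
    ... | no a≢v   = v , a≢v , inj₂ refl
    ... | yes a≡v  = punchIn a zero , Fin.punchInᵢ≢i a zero ∘ sym , inj₁ a≡v
  ... | b , a≢b , a≡v⊎b≡v = contradict (trans (sym (e a b)) (nonadjacent a≡v⊎b≡v))
    where
    a = π ⟨$⟩ˡ v′
    nonadjacent : a ≡ v ⊎ b ≡ v → adj G a b ≡ false
    nonadjacent (inj₁ a≡v) = trans (cong (λ a → adj G a b) a≡v) (iso b)
    nonadjacent (inj₂ b≡v) = trans (cong (adj G a) b≡v) (trans (symm G a v) (iso a))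
    dominating : adj (complement G′) (π ⟨$⟩ʳ a) (π ⟨$⟩ʳ b) ≡ true
    dominating = trans (adj-complement G′ (a≢b ∘ ⟨$⟩ʳ-injective π))
      (cong not (trans (cong (λ i → adj G′ i (π ⟨$⟩ʳ b)) (Perm.inverseʳ π)) (iso′ (π ⟨$⟩ʳ b))))
    contradict : adj (complement G′) (π ⟨$⟩ʳ a) (π ⟨$⟩ʳ b) ≡ false → ⊥
    contradict p with () ← trans (sym p) dominating

  complement-≅ : ∀ {n} {G G′ : Graph n} → complement G ≅ G′ → G ≅ complement G′
  complement-≅ {G = G} {G′} iso with ≅-complement {G = complement G} {G′} iso
  ... | π , e = π , λ i j → trans (sym (complement-complement G i j)) (e i j)

  Λ-clique : ∀ {n} {G : Graph n} {l} → IsClique G l → + Λ H G ≡ A (+ l) (D n 0ℤ)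
  Λ-clique {G = G} K = trans (sym (value-0 G)) (value-clique K 0ℤ)

  Maximal-complement : ∀ {n} (G : Graph n) → Maximal G → Maximal (complement G)
  Maximal-complement G max G′ = subst (Λ H G′ ℕ.≤_) (sym (Λ-complement G)) (max G′)

  -- `below` would name a clique on the same number of vertices with a larger Λ, against maximality.
  Maximal-Side : ∀ {n} (G : Graph n) → Maximal G → Side G 0ℤ →
    ∃[ l ] (Opt n (D n 0ℤ) l × + Λ H G ≡ A (+ l) (D n 0ℤ) × (IsClique G l ⊎ D n 0ℤ ≡ q (+ l)))
  Maximal-Side {n} G max (below l 1≤l l≤n lt) = ⊥-elim (ℤ.<⇒≱ lt
    (subst₂ _≤_ (Λ-clique (initialClique-IsClique l≤n)) (sym (value-0 G)) Λ≤))
    where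
    Λ≤ : + Λ H (initialClique n l) ≤ + Λ H G
    Λ≤ = +≤+ (max (initialClique n l))
  Maximal-Side G max (clique l K o) = l , o , Λ-clique K , inj₁ K
  Maximal-Side G max (tie k 1≤k k<n D≡q eq) =
    k , tie-Opt 1≤k (ℕ.<⇒≤ k<n) D≡q , trans (sym (value-0 G)) eq , inj₂ D≡q

  Maximal-cases : ∀ {n} → 1 ℕ.≤ n → (G : Graph n) → Maximal G → Side G 0ℤ ⊎ Side (complement G) 0ℤ
  Maximal-cases {suc n} _ G max = dichotomy n G (Maximal⇒Nested G max) 0ℤ

  remQuot-injective : ∀ {m} n {i j : Fin (m ℕ.* n)} → Fin.remQuot {m} n i ≡ Fin.remQuot {m} n j → i ≡ j
  remQuot-injective {m} n {i} {j} e = trans (sym (Fin.combine-remQuot {m} n i))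
    (trans (cong (λ p → Fin.combine (proj₁ p) (proj₂ p)) e) (Fin.combine-remQuot {m} n j))

  -- The argument uses only the floor property of k₀ and that the quasi-clique is a clique of order
  -- k + 1, so both enter as parameters.
  module Maximisers (n k : ℕ) (4≤n : 4 ℕ.≤ n) (floor : IsGreatest (_≤x₀[ n ]) k)
    (Q : Graph n) (Q-clique : IsClique Q (suc k)) where
    open Floor n k 4≤n floor

    private
      Λmax-maximal : ∀ G → Λ H G ≡ Λmax H n → Maximal G
      Λmax-maximal G eq G′ = subst (Λ H G′ ℕ.≤_) (sym eq) (proj₂ (Λmax-isMaximum H n) G′)

      1≤n : 1 ℕ.≤ n
      1≤n = ℕ.≤-trans (s≤s z≤n) 4≤n

      Side⇒Λ : ∀ G → Maximal G → Side G 0ℤ → Λ H G ≡ Λ H Q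
      Side⇒Λ G max s =
        let l , o , eq , _ = Maximal-Side G max s in
        ℤ.+-injective (trans eq (trans
          (ℤ.≤-antisym (Opt-maximal Opt-k+1 l (Opt.positive o) (Opt.bounded o)) (Opt-maximal o
              (suc k) (s≤s z≤n) k<n))
          (sym (Λ-clique Q-clique))))

    Λmax≡Λ-QC : Λmax H n ≡ Λ H Q
    Λmax≡Λ-QC = Sum.[ Side⇒Λ M max , trans (sym (Λ-complement M)) ∘ Side⇒Λ (complement M)
        (Maximal-complement M max) ]′
      (Maximal-cases 1≤n M max)
      where
      M = maximiser H n
      max = Λmax-maximal M refl

    unique : ¬ IsSquare (radicand n) → (G : Graph n) → (Λ H G ≡ Λmax H n) ⇔ (G ≅ Q ⊎ G ≅ complement Q)
    unique ¬sq G = mk⇔ to from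
      where
      noTie : ∀ j → 1 ℕ.≤ j → j ℕ.< n → D n 0ℤ ≢ q (+ j)
      noTie j _ _ D≡q = ¬sq (tie⇒IsSquare n j D≡q)
      Side⇒≅ : ∀ G → Maximal G → Side G 0ℤ → G ≅ Q
      Side⇒≅ G max s =
        let l , o , _ , clique⊎tie = Maximal-Side G max s in
        Sum.[ (λ K → IsClique-≅ (subst (IsClique G) (Opt-unique noTie o Opt-k+1) K) Q-clique)
            , (λ D≡q → ⊥-elim (¬sq (tie⇒IsSquare n l D≡q))) ]′ clique⊎tie
      to : Λ H G ≡ Λmax H n → G ≅ Q ⊎ G ≅ complement Q
      to eq = Sum.map (Side⇒≅ G max) (complement-≅ {G = G} {Q} ∘ Side⇒≅ (complement G)
          (Maximal-complement G max)) (Maximal-cases 1≤n G max)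
        where
        max = Λmax-maximal G eq
      from : G ≅ Q ⊎ G ≅ complement Q → Λ H G ≡ Λmax H n
      from (inj₁ i) = trans (Λ-≅ G Q i) (sym Λmax≡Λ-QC)
      from (inj₂ i) = trans (Λ-≅ G (complement Q) i) (trans (Λ-complement Q) (sym Λmax≡Λ-QC))

    private
      -- The clique of order k occupies 0, ..., k - 1. Vertex k is the one joined to j of its
      -- members, and vertex k + 1 stays isolated for every j.
      v : Fin n
      v = fromℕ< k<n

      outside : Fin n
      outside = fromℕ< k+2≤n

      toℕ≤k : (j : Fin (k ℕ.+ 1)) → toℕ j ℕ.≤ k
      toℕ≤k j = ℕ.≤-pred (subst (toℕ j ℕ.<_) (ℕ.+-comm k 1) (Fin.toℕ<n j))

      initial-≥ : ∀ {l} (i : Fin n) → l ℕ.≤ toℕ i → initial l i ≡ false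
      initial-≥ {l} i l≤i = dec-false (toℕ i ℕ.<? l) (ℕ.≤⇒≯ l≤i)

      initial-⊆ : ∀ {l m} → l ℕ.≤ m → ∀ (i : Fin n) → initial l i ≡ true → initial m i ≡ true
      initial-⊆ {l} {m} l≤m i in-l with toℕ i ℕ.<? l
      ... | yes i<l = dec-true (toℕ i ℕ.<? m) (ℕ.<-≤-trans i<l l≤m)
      ... | no i≮l with () ← trans (sym in-l) (dec-false (toℕ i ℕ.<? l) i≮l)

      module P (j : Fin (k ℕ.+ 1)) = Pendant {n} (initial k) (initial (toℕ j)) v
        (initial-≥ v (ℕ.≤-reflexive (sym (Fin.toℕ-fromℕ< k<n))))
        (initial-⊆ (toℕ≤k j))
        (∑-initial k (ℕ.<⇒≤ k<n)) (∑-initial (toℕ j) (ℕ.≤-trans (toℕ≤k j) (ℕ.<⇒≤ k<n)))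

      P-isolated : ∀ j → Isolated (P.graph j) outside
      P-isolated j = P.isolated j outside
        (initial-≥ outside (subst (k ℕ.≤_) (sym (Fin.toℕ-fromℕ< k+2≤n)) (ℕ.n≤1+n k)))
        (λ e → ℕ.1+n≢n (trans (sym (Fin.toℕ-fromℕ< k+2≤n)) (trans (cong toℕ e) (Fin.toℕ-fromℕ< k<n))))

      degSum-P-injective : ∀ {i j} → degSum (P.graph i) ≡ degSum (P.graph j) → i ≡ j
      degSum-P-injective {i} {j} eq = Fin.toℕ-injective (ℤ.+-injective
        (ℤ.*-cancelˡ-≡ (+ 2) (+ toℕ i) (+ toℕ j) (trans (lemma (+ k) (+ toℕ i)) (trans
          (cong (_- + k * (+ k - 1ℤ)) (trans (sym (P.degSum-graph i)) (trans eq
              (P.degSum-graph j)))) (sym (lemma (+ k) (+ toℕ j)))))))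
        where
        lemma : ∀ k i → + 2 * i ≡ k * (k - 1ℤ) + (i + i * 1ℤ) - k * (k - 1ℤ)
        lemma = solve-∀

      P-≇-complement : ∀ i j → ¬ P.graph i ≅ complement (P.graph j)
      P-≇-complement i j = go n 1≤n′ (P.graph i) (P.graph j) (P-isolated i) (P-isolated j)
        where
        1≤n′ : 2 ℕ.≤ n
        1≤n′ = ℕ.≤-trans (s≤s (s≤s z≤n)) 4≤n
        go : ∀ n → 2 ℕ.≤ n → (G G′ : Graph n) {v v′ : Fin n} → Isolated G v → Isolated G′ v′
            → ¬ G ≅ complement G′
        go (suc (suc n)) (s≤s (s≤s z≤n)) = isolated⇒≇complement

    -- As j runs from 0 to k, the first family leads from the clique of order k to that of order k +
    -- 1. Within a family the degree sum tells the graphs apart; between the families it is the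
    -- isolated vertex, which no graph of the second family has.
    variants : Fin 2 × Fin (k ℕ.+ 1) → Graph n
    variants (0F , j) = P.graph j
    variants (1F , j) = complement (P.graph j)

    variants-≇ : ∀ p p′ → p ≢ p′ → ¬ variants p ≅ variants p′
    variants-≇ (0F , i) (0F , j) p≢ iso = p≢ (cong (0F ,_) (degSum-P-injective (degSum-≅
        (P.graph i) (P.graph j) iso)))
    variants-≇ (0F , i) (1F , j) _ iso = P-≇-complement i j iso
    variants-≇ (1F , i) (0F , j) _ iso = P-≇-complement j i (≅-sym {G = complement
        (P.graph i)} {P.graph j} iso)
    variants-≇ (1F , i) (1F , j) p≢ iso = p≢ (cong (1F ,_) (degSum-P-injective (trans
      (degSum-≅ (P.graph i) (complement (complement (P.graph j)))
          (complement-≅ {G = P.graph i} {complement (P.graph j)} iso))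
      (degSum-cong (complement (complement (P.graph j))) (P.graph j) (complement-complement
          (P.graph j))))))

    Λ-variants : D n 0ℤ ≡ q (+ k) → ∀ p → Λ H (variants p) ≡ Λmax H n
    Λ-variants D≡q (1F , j) = trans (Λ-complement (P.graph j)) (Λ-variants D≡q (0F , j))
    Λ-variants D≡q (0F , j) = ℤ.+-injective (begin
      + Λ H (P.graph j)
        ≡⟨ P.Λ-graph j ⟩
      A (+ k) (D n 0ℤ) + + 2 * (+ toℕ j * (D n 0ℤ - q (+ k)))
        ≡⟨ cong (λ d → A (+ k) (D n 0ℤ) + + 2 * (+ toℕ j * d)) slope≡0 ⟩
      A (+ k) (D n 0ℤ) + + 2 * (+ toℕ j * 0ℤ)
        ≡⟨ vanish (A (+ k) (D n 0ℤ)) (+ toℕ j) ⟩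
      A (+ k) (D n 0ℤ)
        ≡⟨ ℤ.i-j≡0⇒i≡j (A (+ suc k) (D n 0ℤ)) (A (+ k) (D n 0ℤ)) (trans (A-step (+ k) (D n 0ℤ))
            (trans (cong (λ d → + 2 * (+ k * d)) slope≡0) (vanish′ (+ k)))) ⟨
      A (+ suc k) (D n 0ℤ)
        ≡⟨ Λ-clique Q-clique ⟨
      + Λ H Q
        ≡⟨ cong +_ Λmax≡Λ-QC ⟨
      + Λmax H n ∎)
      where
      slope≡0 : D n 0ℤ - q (+ k) ≡ 0ℤ
      slope≡0 = ℤ.i≡j⇒i-j≡0 D≡q
      vanish : ∀ a j → a + + 2 * (j * 0ℤ) ≡ a
      vanish = solve-∀
      vanish′ : ∀ j → + 2 * (j * 0ℤ) ≡ 0ℤ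
      vanish′ = solve-∀

    many : IsSquare (radicand n) →
      Σ[ F ∈ (Fin (2 ℕ.* (k ℕ.+ 1)) → Graph n) ]
          (∀ i → Λ H (F i) ≡ Λmax H n)
        × (∀ i j → i ≢ j → ¬ (F i ≅ F j))
    many sq = (λ i → variants (Fin.remQuot {2} (k ℕ.+ 1) i))
      , (λ i → Λ-variants (IsSquare⇒tie sq) (Fin.remQuot {2} (k ℕ.+ 1) i))
      , (λ i j i≢j → variants-≇ (Fin.remQuot {2} (k ℕ.+ 1) i) (Fin.remQuot {2} (k ℕ.+ 1) j)
          (i≢j ∘ remQuot-injective {2} (k ℕ.+ 1)))

open Extremal

open import Data.Nat using (_+_; _*_; _≤_)

theorem3p3 : (n : ℕ) → 4 ≤ n →
    let Q = QC n ((k₀ n + 1) C 2) in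
    (Λmax H n ≡ Λ H Q)
    × (¬ IsSquare (radicand n) →
    (G : Graph n) → (Λ H G ≡ Λmax H n) ⇔ (G ≅ Q ⊎ G ≅ complement Q))
    × (IsSquare (radicand n) →
    Σ[ F ∈ (Fin (2 * (k₀ n + 1)) → Graph n) ]
    (∀ i → Λ H (F i) ≡ Λmax H n)
    × (∀ i j → i ≢ j → ¬ (F i ≅ F j)))
theorem3p3 n 4≤n = Λmax≡Λ-QC , unique , many
  where
  open Maximisers n (k₀ n) 4≤n (k₀-isFloor n 4≤n) (QC n ((k₀ n + 1) C 2))
    (QC-IsClique {n} {k₀ n} (Floor.1≤k n (k₀ n) 4≤n (k₀-isFloor n 4≤n))
      (Floor.k<n n (k₀ n) 4≤n (k₀-isFloor n 4≤n)))
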